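{- Suppose the upper-bound trigger described in the context occurs, and let $r=(r_i)$ be the vector of remaining processing requirements of the $m\ge1$ jobs unfinished at the trigger time (fallback entry). For $D>1$ define $$\alpha_m(c)=1+c-\frac{2c}{m+1},\qquad \beta_1(D)=0,\qquad \beta_K(D)=\max_{1\le q<K} qD^{ -q/K}\quad(K\ge2),$$ where $q$ ranges over integers. Then for $D>1$, every finite integer $K\ge1$ and every $\lambda=\kappa/s_0\ge0$, the geometric fallback $G_K$ satisfies $$F^{\rm res}_{G_K}(r)\le\alpha_m(D^{1/K})\operatorname{OPT}(r),\qquad P^{\rm res}_{G_K}(r)\le\frac{\beta_K(D)}{s_0}\sum_i r_i,$$ and $$F^{\rm res}_{G_K}(r)+\kappa P^{\rm res}_{G_K}(r)\le\Psi_{m,D,\lambda}(K)\operatorname{OPT}(r),\qquad \Psi_{m,D,\lambda}(K)=\alpha_m(D^{1/K})+\lambda\beta_K(D).$$ For $D=1$ and $K=1$, the residual service is in SPT (shortest remaining size first) order without charged interruptions, and the exact coefficient is one for every $\kappa\ge0$: $F^{\rm res}_{G_1}(r)+\kappa P^{\rm res}_{G_1}(r)=\operatorname{OPT}(r)$.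
   Context: Instance: $n\ge1$ jobs, all released at time zero, on one unit-speed machine on which jobs are resumable (interrupted jobs keep the service received). Job $j$ has an unknown processing requirement $p_j$ and a reported interval $[\ell_j,u_j]$, $0<\ell_j\le u_j<\infty$ (possibly wrong). Known constants satisfy $0<s_0\le p_j\le s_1<\infty$ for all $j$, and $D=s_1/s_0$. Interruption cost: an interruption is charged exactly when the scheduler switches away from a job that is still unfinished; starts from idle and departures at completion are free, and consecutive service phases of the same job are merged (no charge). Each charged interruption costs $\kappa\ge0$; $\lambda=\kappa/s_0$. Trigger: jobs are run nonpreemptively in nondecreasing order of $u_j$ (ties by a fixed label rule). When a running job has received exactly $u_j$ units of service, completion is checked first; if it is still unfinished, the trigger occurs immediately, at time $\tau$. If the first such job is $e=\pi(q)$ in position $q$, then $\tau=\sum_{a<q}p_{\pi(a)}+u_e$; the residual vector is $r_e=p_e-u_e>0$ and $r_j=p_j$ for the jobs $j$ after $e$ in the list. The current job $e$ continues at the trigger, so entering the fallback creates no charged interruption. Geometric fallback $G_K$ (integer $K\ge1$; for $D=1$ only $K=1$ is used): let $c=D^{1/K}$ and $T_h=s_0c^{h+1}$ for $h=0,\dots,K-1$ (so $T_{K-1}=s_1$), $T_{ -1}=0$. From time $\tau$ on, order the unfinished jobs with the triggering job first and then the others in the inherited upper-endpoint order. In rounds $h=0,1,\dots,K-1$, go through the unfinished jobs in this order, serving each until it completes or until its cumulative fallback service (service received after $\tau$) reaches $T_h$. A job completing at a threshold is removed before any later activation. $F^{\rm res}_{G_K}(r)$ is the sum over the $m$ residual jobs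 of (completion time minus $\tau$), and $P^{\rm res}_{G_K}(r)$ is the number of charged interruptions from fallback entry on. $\operatorname{OPT}(r)=\sum_{i=1}^m(m-i+1)r_{(i)}$ with $r_{(1)}\le\cdots\le r_{(m)}$, the minimum total completion time for sizes $r$. -}

module Defs where

open import Level using (suc; _⊔_)
open import Algebra.Bundles using (CommutativeRing; Semiring)
open import Algebra.Core using (Op₁; Op₂)
open import Algebra.Structures using (IsCommutativeRing)
import Algebra.Construct.NaturalChoice.Max as Max
import Algebra.Definitions.RawSemiring as RawSemiringDefs
open import Data.Bool.Base using (Bool; true; false; if_then_else_; _∨_)
open import Data.Fin.Base using (Fin)
open import Data.Fin.Properties using (_≟_)
open import Data.List.Base
  using (List; []; _∷_; _++_; map; foldr; filter; length; allFin; applyUpTo)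
open import Data.List.Relation.Binary.Permutation.Propositional using (_↭_)
open import Data.List.Relation.Unary.All using (All)
open import Data.List.Relation.Unary.AllPairs using (AllPairs)
import Data.List.Relation.Unary.Sorted.TotalOrder as SortedDefs
import Data.List.Sort as Sort
open import Data.Maybe.Base using (Maybe; just; nothing)
import Data.Nat.Base as ℕ
open import Data.Nat.Base using (ℕ; NonZero)
open import Data.Product.Base using (_×_; _,_)
open import Data.Sum.Base using (_⊎_)
open import Function.Definitions using (Injective)
open import Relation.Binary.Bundles using (DecTotalOrder)
open import Relation.Binary.Core using (Rel)
open import Relation.Binary.PropositionalEquality.Core using (_≡_)
open import Relation.Binary.Structures using (IsDecTotalOrder)
import Relation.Binary.Construct.NonStrictToStrict as ToStrict
open import Relation.Nullary using (¬_; does; ¬?; yes; no)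

-- The interface through which the real numbers are used: an ordered field
-- with decidable order in which positive elements have positive K-th roots.
-- Classically ℝ is an instance.  The values 0# ⁻¹, root 0 x, and root K x for
-- x not positive are unspecified.
record RootedOrderedField a ℓ₁ ℓ₂ : Set (suc (a ⊔ ℓ₁ ⊔ ℓ₂)) where
  infix  9 _⁻¹
  infix  8 -_
  infixl 7 _*_
  infixl 6 _+_
  infix  4 _≈_ _≤_
  field
    Carrier           : Set a
    _≈_               : Rel Carrier ℓ₁
    _≤_               : Rel Carrier ℓ₂
    _+_               : Op₂ Carrier
    _*_               : Op₂ Carrier
    -_                : Op₁ Carrier
    0#                : Carrier
    1#                : Carrier
    _⁻¹               : Op₁ Carrier
    root              : ℕ → Carrier → Carrier
    isCommutativeRing : IsCommutativeRing _≈_ _+_ _*_ -_ 0# 1#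
    isDecTotalOrder   : IsDecTotalOrder _≈_ _≤_

  commutativeRing : CommutativeRing a ℓ₁
  commutativeRing = record { isCommutativeRing = isCommutativeRing }

  decTotalOrder : DecTotalOrder a ℓ₁ ℓ₂
  decTotalOrder = record { isDecTotalOrder = isDecTotalOrder }

  open DecTotalOrder decTotalOrder public using (_≤?_; totalOrder)
  open CommutativeRing commutativeRing public using (_-_; semiring)
  open Semiring semiring public using (rawSemiring)
  open ToStrict _≈_ _≤_ public using (_<_)
  open RawSemiringDefs rawSemiring public using (_^_) renaming (_×_ to _·_)

  field
    0≉1         : ¬ (0# ≈ 1#)
    +-monoˡ-≤   : ∀ {x y} z → x ≤ y → x + z ≤ y + z
    *-nonNeg    : ∀ {x y} → 0# ≤ x → 0# ≤ y → 0# ≤ x * y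
    *-inverseʳ  : ∀ {x} → ¬ (x ≈ 0#) → x * x ⁻¹ ≈ 1#
    root-pos    : ∀ K .{{_ : NonZero K}} {x} → 0# < x → 0# < root K x
    root-^      : ∀ K .{{_ : NonZero K}} {x} → 0# < x → root K x ^ K ≈ x

module Scheduling {a ℓ₁ ℓ₂} (𝔽 : RootedOrderedField a ℓ₁ ℓ₂) where

  open RootedOrderedField 𝔽
  open Max totalOrder using () renaming (_⊔_ to max)

  infixl 7 _/_
  _/_ : Op₂ Carrier
  x / y = x * y ⁻¹

  fromℕ : ℕ → Carrier
  fromℕ n = n · 1#

  sum : List Carrier → Carrier
  sum = foldr _+_ 0#

  record Instance : Set (a ⊔ ℓ₁ ⊔ ℓ₂) where
    field
      n         : ℕ
      n≥1       : 1 ℕ.≤ n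
      p ℓ u     : Fin n → Carrier
      s₀ s₁ κ   : Carrier
      0<ℓ       : ∀ j → 0# < ℓ j
      ℓ≤u       : ∀ j → ℓ j ≤ u j
      0<s₀      : 0# < s₀
      s₀≤p      : ∀ j → s₀ ≤ p j
      p≤s₁      : ∀ j → p j ≤ s₁
      0≤κ       : 0# ≤ κ
      label     : Fin n → ℕ
      label-inj : Injective _≡_ _≡_ label

    D : Carrier
    D = s₁ / s₀

    Λ : Carrier
    Λ = κ / s₀

  -- Σᵢ (m - i + 1) r₍ᵢ₎: in the sorted list, the weight of an entry is the
  -- length of the suffix that starts at it.
  suffixWeighted : List Carrier → Carrier
  suffixWeighted []       = 0#
  suffixWeighted (x ∷ xs) = fromℕ (length (x ∷ xs)) * x + suffixWeighted xs

  OPT : List Carrier → Carrier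
  OPT rs = suffixWeighted (Sort.sort decTotalOrder rs)

  α : ℕ → Carrier → Carrier
  α m c = 1# + c - (fromℕ 2 * c) / fromℕ (m ℕ.+ 1)

  -- q D^(-q/K)
  βterm : Carrier → ℕ → ℕ → Carrier
  βterm D K q = fromℕ q * (root K D ⁻¹) ^ q

  -- For K = k + 2, q ranges over 1 and 2 + i with i < k.
  β : ℕ → Carrier → Carrier
  β 0                     D = 0#
  β 1                     D = 0#
  β K@(ℕ.suc (ℕ.suc k))   D =
    foldr max (βterm D K 1) (applyUpTo (λ i → βterm D K (2 ℕ.+ i)) k)

  Ψ : ℕ → Carrier → Carrier → ℕ → Carrier
  Ψ m D Λ K = α m (root K D) + Λ * β K D

  module _ (I : Instance) where
    open Instance I

    Job : Set
    Job = Fin n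

    record UpperEndpointOrder (π : List Job) : Set (a ⊔ ℓ₁ ⊔ ℓ₂) where
      field
        perm   : π ↭ allFin n
        sorted : AllPairs (λ i j → u i < u j ⊎ (u i ≈ u j × label i ℕ.< label j)) π

    record Trigger : Set a where
      constructor trigger
      field
        τ     : Carrier
        e     : Job
        later : List Job

    -- Runs the listed jobs nonpreemptively from time t; nothing means that no
    -- trigger occurs.
    runUpper : Carrier → List Job → Maybe Trigger
    runUpper t []       = nothing
    runUpper t (j ∷ js) with p j ≤? u j
    ... | yes _ = runUpper (t + p j) js
    ... | no  _ = just (trigger (t + u j) j js)

    -- A maximal stretch of service to one job within one round; `completes`
    -- tells whether the job is finished at its end.
    record Phase : Set a where
      constructor phase
      field
        job       : Job
        amount    : Carrier
        completes : Bool
    open Phase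

    completionTime : Carrier → List Phase → Job → Carrier
    -- Default value for a job that the phases never complete.
    completionTime t []         j = t
    completionTime t (ph ∷ phs) j with job ph ≟ j | completes ph
    ... | yes _ | true = t + amount ph
    ... | _     | _    = completionTime (t + amount ph) phs j

    charge : Phase → Phase → ℕ
    charge x y = if completes x ∨ does (job x ≟ job y) then 0 else 1

    interruptions : Phase → List Phase → ℕ
    interruptions x []       = 0
    interruptions x (y ∷ ys) = charge x y ℕ.+ interruptions y ys

    module Fallback (tr : Trigger) where
      open Trigger tr

      unfinished : List Job
      unfinished = e ∷ later

      m : ℕ
      m = length unfinished

      r : Job → Carrier
      r j = if does (j ≟ e) then p j - u j else p j

      residuals : List Carrier
      residuals = map r unfinished

      -- An unfinished job together with its cumulative fallback service.
      Active : Set a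
      Active = Job × Carrier

      serve : Carrier → Active → Phase
      serve T (j , x) = if does (r j ≤? T) then phase j (r j - x) true
                                           else phase j (T - x) false

      survivors : Carrier → List Active → List Active
      survivors T as =
        map (λ (j , _) → j , T) (filter (λ (j , _) → ¬? (r j ≤? T)) as)

      rounds : List Carrier → List Active → List Phase
      rounds []       as = []
      rounds (T ∷ Ts) as = map (serve T) as ++ rounds Ts (survivors T as)

      thresholds : ℕ → List Carrier
      thresholds K = applyUpTo (λ h → s₀ * root K D ^ (h ℕ.+ 1)) K

      G : ℕ → List Phase
      G K = rounds (thresholds K) (map (λ j → j , 0#) unfinished)

      -- Since T_{K-1} = s₁ ≥ r j, every unfinished job has a completing phase
      -- in G K.
      Fres : ℕ → Carrier
      Fres K = sum (map (λ j → completionTime τ (G K) j - τ) unfinished)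

      -- The phase before fallback entry is the unfinished service to e, so a
      -- switch at entry would be charged.
      Pres : ℕ → ℕ
      Pres K = interruptions (phase e (u e) false) (G K)

      -- Every residual job is served in a single phase, to completion, in
      -- nondecreasing order of remaining size.
      SPT : List Phase → Set (a ⊔ ℓ₂)
      SPT phs = All (λ ph → completes ph ≡ true) phs
              × map job phs ↭ unfinished
              × SortedDefs.Sorted totalOrder (map (λ ph → r (job ph)) phs)

{-# OPTIONS --safe #-}
module Submission where

-- A pair of jobs delays each other, over the whole fallback, by at most
-- (1 + c) times the smaller size μ of the two: when the first of them completes,
-- one of the two has received at most μ and the other at most c μ, since
-- consecutive thresholds grow by the factor c and every job but the first one
-- in the list has size at least s₀.
-- With S the sum of the sizes and M the sum of the pairwise minima this gives
-- Fres ≤ S + (1 + c) M, whereas OPT = S + M and 2 OPT ≤ (m + 1) S; together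
-- these yield the coefficient α.  A job interrupted q ≥ 1 times is larger than
-- s₀ c^q, so it pays for its interruptions at rate q c^(-q) / s₀ ≤ β / s₀.

open import Defs
open import Algebra.Bundles using (CommutativeRing)
import Algebra.Construct.NaturalChoice.Max as Max
import Algebra.Construct.NaturalChoice.Min as Min
import Algebra.Properties.AbelianGroup as AbelianGroupProperties
import Algebra.Properties.Monoid.Mult as UMonoidMult
import Algebra.Properties.Monoid.Mult.TCOptimised as MonoidMult
import Algebra.Properties.Ring as RingProperties
import Algebra.Properties.Semiring.Mult.TCOptimised as SemiringMult
import Algebra.Solver.Ring as RingSolver
open import Algebra.Solver.Ring.AlmostCommutativeRing
  using (AlmostCommutativeRing; fromCommutativeRing; _-Raw-AlmostCommutative⟶_; Induced-equivalence)
open import Data.Bool.Base using (true; false; if_then_else_)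
import Data.Fin.Properties as Finₚ
import Data.Integer.Base as ℤ
open import Data.Integer.Base using (ℤ; +_; -[1+_])
import Data.Integer.Properties as ℤₚ
open import Data.List.Base using (List; []; _∷_; _∷ʳ_; _++_; map; length; foldr; applyUpTo)
import Data.List.Properties as Listₚ
open import Data.List.Relation.Binary.Permutation.Propositional
  using (_↭_; prep; swap) renaming (refl to ↭-refl; trans to ↭-trans)
open import Data.List.Relation.Binary.Permutation.Propositional.Properties using (shift)
open import Data.List.Relation.Unary.All as All using (All; []; _∷_)
import Data.List.Relation.Unary.All.Properties as Allₚ
open import Data.List.Relation.Unary.AllPairs as AllPairs using (AllPairs; []; _∷_)
import Data.List.Relation.Unary.AllPairs.Properties as AllPairsₚ
open import Data.List.Relation.Unary.Any using (Any; here; there)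
import Data.List.Relation.Unary.Any.Properties as Anyₚ
open import Data.List.Relation.Unary.Linked using (Linked; _∷_)
import Data.List.Relation.Unary.Linked.Properties as Linkedₚ
open import Data.List.Relation.Unary.Sorted.TotalOrder using (Sorted)
import Data.List.Relation.Unary.Sorted.TotalOrder.Properties as Sortedₚ
open import Data.List.Relation.Unary.Unique.Propositional using (Unique)
import Data.List.Sort as Sort
open import Data.Maybe.Base using (just; nothing)
import Data.Nat.Base as ℕ
open import Data.Nat.Base using (ℕ; NonZero)
import Data.Nat.Properties as ℕₚ
open import Data.Product.Base using (_×_; _,_; proj₁; proj₂; Σ-syntax)
open import Data.Sum.Base using (_⊎_; inj₁; inj₂)
open import Function.Base using (_∘_; id)
import Level
open import Relation.Binary.Bundles using (DecTotalOrder)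
open import Relation.Binary.Definitions using (WeaklyDecidable)
import Relation.Binary.PropositionalEquality as ≡
open import Relation.Binary.PropositionalEquality using (_≡_)
import Relation.Binary.Reasoning.PartialOrder as PosetReasoning
import Relation.Binary.Reasoning.Setoid as SetoidReasoning
open import Relation.Nullary using (¬_; does; yes; no; contradiction)

-- The pairwise delays are never extracted from the schedule. Instead a potential, `budget`, is
-- carried through the phases: for each unfinished job the current time plus its missing service,
-- and for each pair the delay still allowed. An unfinished phase leaves it unchanged, and a
-- completion costs one inequality per other job, so sizes and services need to be compared only at
-- completions.
--
-- The triggering job is the obstacle: its residual is positive but can be far below `s₀`, so it may
-- be smaller than the first threshold divided by `c`. The growth condition is therefore imposed
-- only on the later job of an ordered pair. In the first round the head either completes before any
-- other job is served, or it has reached the threshold, hence is at least that large, when another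
-- job completes. From the second round on every job has survived the previous threshold and there
-- is no exception.
--
-- Nothing survives the last round, whose threshold is `s₁`. Hence a job has at most `K - 1`
-- unfinished phases, which is why `β` stops at `q < K` and vanishes for `K = 1`.

AllPairs-from-All : ∀ {a p ℓ} {A : Set a} {P : A → Set p} {R : A → A → Set ℓ} →
  (∀ x {y} → P y → R x y) → ∀ x {xs} → All P xs → AllPairs R (x ∷ xs)
AllPairs-from-All f x []         = [] ∷ []
AllPairs-from-All f x (py ∷ pys) = All.map (f x) (py ∷ pys) ∷ AllPairs-from-All f _ pys

AllPairs-++ʳ : ∀ {a ℓ} {A : Set a} {R : A → A → Set ℓ} xs {ys} → AllPairs R (xs ++ ys) → AllPairs R ys
AllPairs-++ʳ []       Rys          = Rys
AllPairs-++ʳ (x ∷ xs) (_ ∷ Rxs++ys) = AllPairs-++ʳ xs Rxs++ys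

-- Coefficients in ℤ, whose equality is decidable, let the ring solver cancel
-- opposite terms, which it cannot do with coefficients in an abstract ring.

module IntegerSolver {c ℓ} (R : CommutativeRing c ℓ) where
  open CommutativeRing R
  open RingProperties ring
  open AbelianGroupProperties +-abelianGroup using (⁻¹-∙-comm; ε⁻¹≈ε; ⁻¹-involutive)
  open SetoidReasoning setoid
  open MonoidMult +-monoid using (×-homo-+) renaming (_×_ to infixl 8 _×′_)
  open SemiringMult semiring using (×1-homo-*; 1+×)

  -- The optimised multiple `×′` makes `+ 1` evaluate to `1#` itself and not to `1# + 0#`, so
  -- `con (+ 1)` matches the `1#` of a goal.
  ⟦_⟧ᶻ : ℤ → Carrier
  ⟦ + n ⟧ᶻ      = n ×′ 1#
  ⟦ -[1+ n ] ⟧ᶻ = - (ℕ.suc n ×′ 1#)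

  1+-cancel : ∀ x y → x - y ≈ (1# + x) - (1# + y)
  1+-cancel x y = begin
    x - y                       ≈⟨ +-identityˡ (x - y) ⟨
    0# + (x - y)                ≈⟨ +-congʳ (-‿inverseʳ 1#) ⟨
    (1# - 1#) + (x - y)         ≈⟨ +-assoc 1# (- 1#) (x - y) ⟩
    1# + (- 1# + (x - y))       ≈⟨ +-congˡ (+-assoc (- 1#) x (- y)) ⟨
    1# + ((- 1# + x) - y)       ≈⟨ +-congˡ (+-congʳ (+-comm (- 1#) x)) ⟩
    1# + ((x - 1#) - y)         ≈⟨ +-congˡ (+-assoc x (- 1#) (- y)) ⟩
    1# + (x + (- 1# - y))       ≈⟨ +-congˡ (+-congˡ (⁻¹-∙-comm 1# y)) ⟩
    1# + (x - (1# + y))         ≈⟨ +-assoc 1# x (- (1# + y)) ⟨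
    (1# + x) - (1# + y)         ∎

  ⊖-homo : ∀ m n → ⟦ m ℤ.⊖ n ⟧ᶻ ≈ m ×′ 1# - n ×′ 1#
  ⊖-homo m ℕ.zero = begin
    ⟦ m ℤ.⊖ 0 ⟧ᶻ  ≡⟨ ≡.cong ⟦_⟧ᶻ (ℤₚ.⊖-≥ {m} ℕ.z≤n) ⟩
    m ×′ 1#       ≈⟨ +-identityʳ _ ⟨
    m ×′ 1# + 0#  ≈⟨ +-congˡ ε⁻¹≈ε ⟨
    m ×′ 1# - 0#  ∎
  ⊖-homo ℕ.zero (ℕ.suc n) = sym (+-identityˡ _)
  ⊖-homo (ℕ.suc m) (ℕ.suc n) = begin
    ⟦ ℕ.suc m ℤ.⊖ ℕ.suc n ⟧ᶻ               ≡⟨ ≡.cong ⟦_⟧ᶻ (ℤₚ.[1+m]⊖[1+n]≡m⊖n m n) ⟩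
    ⟦ m ℤ.⊖ n ⟧ᶻ                           ≈⟨ ⊖-homo m n ⟩
    m ×′ 1# - n ×′ 1#                      ≈⟨ 1+-cancel (m ×′ 1#) (n ×′ 1#) ⟩
    (1# + m ×′ 1#) - (1# + n ×′ 1#)        ≈⟨ +-cong (1+× m 1#) (-‿cong (1+× n 1#)) ⟨
    ℕ.suc m ×′ 1# - ℕ.suc n ×′ 1#          ∎

  +-homoᶻ : ∀ i j → ⟦ i ℤ.+ j ⟧ᶻ ≈ ⟦ i ⟧ᶻ + ⟦ j ⟧ᶻ
  +-homoᶻ (+ m)      (+ n)      = ×-homo-+ 1# m n
  +-homoᶻ (+ m)      -[1+ n ]   = ⊖-homo m (ℕ.suc n)
  +-homoᶻ -[1+ m ]   (+ n)      = trans (⊖-homo n (ℕ.suc m)) (+-comm _ _)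
  +-homoᶻ -[1+ m ]   -[1+ n ]   = begin
    - (ℕ.suc (ℕ.suc (m ℕ.+ n)) ×′ 1#)            ≡⟨ ≡.cong (λ k → - (k ×′ 1#)) (≡.cong ℕ.suc (ℕₚ.+-suc m n)) ⟨
    - ((ℕ.suc m ℕ.+ ℕ.suc n) ×′ 1#)              ≈⟨ -‿cong (×-homo-+ 1# (ℕ.suc m) (ℕ.suc n)) ⟩
    - (ℕ.suc m ×′ 1# + ℕ.suc n ×′ 1#)            ≈⟨ ⁻¹-∙-comm _ _ ⟨
    - (ℕ.suc m ×′ 1#) - ℕ.suc n ×′ 1#            ∎

  -‿homoᶻ : ∀ i → ⟦ ℤ.- i ⟧ᶻ ≈ - ⟦ i ⟧ᶻ
  -‿homoᶻ (+ ℕ.zero)  = sym ε⁻¹≈ε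
  -‿homoᶻ (+ ℕ.suc n) = refl
  -‿homoᶻ -[1+ n ]    = sym (⁻¹-involutive _)

  +*-homoᶻ : ∀ m j → ⟦ + m ℤ.* j ⟧ᶻ ≈ ⟦ + m ⟧ᶻ * ⟦ j ⟧ᶻ
  +*-homoᶻ m (+ n) = begin
    ⟦ + m ℤ.* + n ⟧ᶻ      ≡⟨ ≡.cong ⟦_⟧ᶻ (ℤₚ.pos-* m n) ⟨
    (m ℕ.* n) ×′ 1#       ≈⟨ ×1-homo-* m n ⟩
    m ×′ 1# * n ×′ 1#     ∎
  +*-homoᶻ m -[1+ n ] = begin
    ⟦ + m ℤ.* ℤ.- (+ ℕ.suc n) ⟧ᶻ     ≡⟨ ≡.cong ⟦_⟧ᶻ (ℤₚ.neg-distribʳ-* (+ m) (+ ℕ.suc n)) ⟨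
    ⟦ ℤ.- (+ m ℤ.* + ℕ.suc n) ⟧ᶻ     ≈⟨ -‿homoᶻ (+ m ℤ.* + ℕ.suc n) ⟩
    - ⟦ + m ℤ.* + ℕ.suc n ⟧ᶻ         ≈⟨ -‿cong (+*-homoᶻ m (+ ℕ.suc n)) ⟩
    - (m ×′ 1# * ℕ.suc n ×′ 1#)      ≈⟨ -‿distribʳ-* _ _ ⟩
    m ×′ 1# * - (ℕ.suc n ×′ 1#)      ∎

  *-homoᶻ : ∀ i j → ⟦ i ℤ.* j ⟧ᶻ ≈ ⟦ i ⟧ᶻ * ⟦ j ⟧ᶻ
  *-homoᶻ (+ m)    j = +*-homoᶻ m j
  *-homoᶻ -[1+ m ] j = begin
    ⟦ ℤ.- (+ ℕ.suc m) ℤ.* j ⟧ᶻ     ≡⟨ ≡.cong ⟦_⟧ᶻ (ℤₚ.neg-distribˡ-* (+ ℕ.suc m) j) ⟨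
    ⟦ ℤ.- (+ ℕ.suc m ℤ.* j) ⟧ᶻ     ≈⟨ -‿homoᶻ (+ ℕ.suc m ℤ.* j) ⟩
    - ⟦ + ℕ.suc m ℤ.* j ⟧ᶻ         ≈⟨ -‿cong (+*-homoᶻ (ℕ.suc m) j) ⟩
    - (ℕ.suc m ×′ 1# * ⟦ j ⟧ᶻ)     ≈⟨ -‿distribˡ-* _ _ ⟩
    - (ℕ.suc m ×′ 1#) * ⟦ j ⟧ᶻ     ∎

  almostCommutativeRing : AlmostCommutativeRing c ℓ
  almostCommutativeRing = fromCommutativeRing R

  morphism : ℤ.+-*-rawRing -Raw-AlmostCommutative⟶ almostCommutativeRing
  morphism = record
    { ⟦_⟧    = ⟦_⟧ᶻ
    ; +-homo = +-homoᶻ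
    ; *-homo = *-homoᶻ
    ; -‿homo = -‿homoᶻ
    ; 0-homo = refl
    ; 1-homo = refl
    }

  _coeff≟_ : WeaklyDecidable (Induced-equivalence morphism)
  i coeff≟ j with i ℤₚ.≟ j
  ... | yes ≡.refl = just refl
  ... | no  _      = nothing

  open RingSolver ℤ.+-*-rawRing almostCommutativeRing morphism _coeff≟_ public
    using (solve; _:=_; _:+_; _:*_; _:-_; con)

-- Ordered fields

module OrderedFieldProperties {a ℓ₁ ℓ₂} (𝔽 : RootedOrderedField a ℓ₁ ℓ₂) where
  open RootedOrderedField 𝔽
  open CommutativeRing commutativeRing public
    using ( refl; sym; trans; reflexive; +-cong; +-congˡ; +-congʳ; +-identityʳ; +-identityˡ; +-comm; +-assoc
          ; *-cong; *-congˡ; *-congʳ; *-identityʳ; *-identityˡ; *-comm; *-assoc; distribˡ; distribʳ; zeroʳ; zeroˡ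
          ; -‿inverseʳ; -‿cong)
  open DecTotalOrder decTotalOrder public
    using (≤-respˡ-≈; ≤-respʳ-≈; poset; total)
    renaming (refl to ≤-refl; trans to ≤-trans; antisym to ≤-antisym; reflexive to ≤-reflexive)
  open IntegerSolver commutativeRing public using (solve; _:=_; _:+_; _:*_; _:-_; con)
  open Min totalOrder public using (_⊓_; ⊓-comm; x⊓y≤x; x⊓y≤y; ⊓-sel; ⊓-glb; x≤y⇒x⊓y≈x)
  open Max totalOrder public using (_⊔_; x≤x⊔y; x≤y⊔x)
  open PosetReasoning poset

  ≰⇒≥ : ∀ {x y} → ¬ (x ≤ y) → y ≤ x
  ≰⇒≥ {x} {y} x≰y with total x y
  ... | inj₁ x≤y = contradiction x≤y x≰y
  ... | inj₂ y≤x = y≤x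

  +-mono-≤ : ∀ {x y u v} → x ≤ y → u ≤ v → x + u ≤ y + v
  +-mono-≤ {x} {y} {u} {v} x≤y u≤v = begin
    x + u  ≤⟨ +-monoˡ-≤ u x≤y ⟩
    y + u  ≈⟨ +-comm y u ⟩
    u + y  ≤⟨ +-monoˡ-≤ y u≤v ⟩
    v + y  ≈⟨ +-comm v y ⟩
    y + v  ∎

  +-monoʳ-≤ : ∀ z {x y} → x ≤ y → z + x ≤ z + y
  +-monoʳ-≤ z = +-mono-≤ ≤-refl

  x≤y⇒0≤y-x : ∀ {x y} → x ≤ y → 0# ≤ y - x
  x≤y⇒0≤y-x {x} x≤y = ≤-respˡ-≈ (-‿inverseʳ x) (+-monoˡ-≤ (- x) x≤y)

  0≤y-x⇒x≤y : ∀ {x y} → 0# ≤ y - x → x ≤ y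
  0≤y-x⇒x≤y {x} {y} 0≤y-x = begin
    x            ≈⟨ +-identityˡ x ⟨
    0# + x       ≤⟨ +-monoˡ-≤ x 0≤y-x ⟩
    y - x + x    ≈⟨ solve 2 (λ x y → y :- x :+ x := y) refl x y ⟩
    y            ∎

  +-nonNeg : ∀ {x y} → 0# ≤ x → 0# ≤ y → 0# ≤ x + y
  +-nonNeg 0≤x 0≤y = ≤-respˡ-≈ (+-identityʳ 0#) (+-mono-≤ 0≤x 0≤y)

  *-monoˡ-nonNeg : ∀ {z x y} → 0# ≤ z → x ≤ y → z * x ≤ z * y
  *-monoˡ-nonNeg {z} {x} {y} 0≤z x≤y = 0≤y-x⇒x≤y
    (≤-respʳ-≈ (solve 3 (λ x y z → z :* (y :- x) := z :* y :- z :* x) refl x y z)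
               (*-nonNeg 0≤z (x≤y⇒0≤y-x x≤y)))

  *-monoʳ-nonNeg : ∀ {z x y} → 0# ≤ z → x ≤ y → x * z ≤ y * z
  *-monoʳ-nonNeg {z} {x} {y} 0≤z x≤y = begin
    x * z  ≈⟨ *-comm x z ⟩
    z * x  ≤⟨ *-monoˡ-nonNeg 0≤z x≤y ⟩
    z * y  ≈⟨ *-comm z y ⟩
    y * z  ∎

  0≤1 : 0# ≤ 1#
  0≤1 with total 0# 1#
  ... | inj₁ 0≤1 = 0≤1
  ... | inj₂ 1≤0 = ≤-respʳ-≈ (solve 0 ((con (+ 0) :- con (+ 1)) :* (con (+ 0) :- con (+ 1)) := con (+ 1)) refl)
                     (*-nonNeg (x≤y⇒0≤y-x 1≤0) (x≤y⇒0≤y-x 1≤0))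

  0<⇒≉0 : ∀ {x} → 0# < x → ¬ (x ≈ 0#)
  0<⇒≉0 (_ , 0≉x) = 0≉x ∘ sym

  <-≤-trans : ∀ {x y z} → x < y → y ≤ z → x < z
  <-≤-trans (x≤y , x≉y) y≤z = ≤-trans x≤y y≤z , λ x≈z → x≉y (≤-antisym x≤y (≤-respʳ-≈ (sym x≈z) y≤z))

  *-inverse-cancelˡ : ∀ {x} → ¬ (x ≈ 0#) → ∀ y → x * (y * x ⁻¹) ≈ y
  *-inverse-cancelˡ {x} x≉0 y = begin-equality
    x * (y * x ⁻¹)  ≈⟨ solve 3 (λ x y i → x :* (y :* i) := y :* (x :* i)) refl x y (x ⁻¹) ⟩
    y * (x * x ⁻¹)  ≈⟨ *-congˡ (*-inverseʳ x≉0) ⟩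
    y * 1#          ≈⟨ *-identityʳ y ⟩
    y               ∎

  *-cancelˡ-≤ : ∀ {z x y} → 0# < z → z * x ≤ z * y → x ≤ y
  *-cancelˡ-≤ {z} {x} {y} 0<z zx≤zy with total x y
  ... | inj₁ x≤y = x≤y
  ... | inj₂ y≤x = ≤-reflexive (begin-equality
    x               ≈⟨ *-inverse-cancelˡ (0<⇒≉0 0<z) x ⟨
    z * (x * z ⁻¹)  ≈⟨ *-assoc z x (z ⁻¹) ⟨
    z * x * z ⁻¹    ≈⟨ *-congʳ (≤-antisym zx≤zy (*-monoˡ-nonNeg (proj₁ 0<z) y≤x)) ⟩
    z * y * z ⁻¹    ≈⟨ *-assoc z y (z ⁻¹) ⟩
    z * (y * z ⁻¹)  ≈⟨ *-inverse-cancelˡ (0<⇒≉0 0<z) y ⟩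
    y               ∎)

  ⁻¹-nonNeg : ∀ {x} → 0# < x → 0# ≤ x ⁻¹
  ⁻¹-nonNeg {x} 0<x = *-cancelˡ-≤ 0<x (begin
    x * 0#    ≈⟨ zeroʳ x ⟩
    0#        ≤⟨ 0≤1 ⟩
    1#        ≈⟨ *-inverseʳ (0<⇒≉0 0<x) ⟨
    x * x ⁻¹  ∎)

  ^-nonNeg : ∀ {x} n → 0# ≤ x → 0# ≤ x ^ n
  ^-nonNeg ℕ.zero    0≤x = 0≤1
  ^-nonNeg (ℕ.suc n) 0≤x = *-nonNeg 0≤x (^-nonNeg n 0≤x)

  x≤1⇒x^n≤1 : ∀ {x} n → 0# ≤ x → x ≤ 1# → x ^ n ≤ 1#
  x≤1⇒x^n≤1         ℕ.zero    0≤x x≤1 = ≤-refl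
  x≤1⇒x^n≤1 {x} (ℕ.suc n) 0≤x x≤1 = begin
    x * x ^ n  ≤⟨ *-monoˡ-nonNeg 0≤x (x≤1⇒x^n≤1 n 0≤x x≤1) ⟩
    x * 1#     ≈⟨ *-identityʳ x ⟩
    x          ≤⟨ x≤1 ⟩
    1#         ∎

  ⁻¹^n*^n≈1 : ∀ {x} n → ¬ (x ≈ 0#) → (x ⁻¹) ^ n * x ^ n ≈ 1#
  ⁻¹^n*^n≈1     ℕ.zero    x≉0 = *-identityʳ 1#
  ⁻¹^n*^n≈1 {x} (ℕ.suc n) x≉0 = begin-equality
    (x ⁻¹ * (x ⁻¹) ^ n) * (x * x ^ n)    ≈⟨ solve 4 (λ x i p q → (i :* p) :* (x :* q) := (x :* i) :* (p :* q))
                                              refl x (x ⁻¹) ((x ⁻¹) ^ n) (x ^ n) ⟩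
    (x * x ⁻¹) * ((x ⁻¹) ^ n * x ^ n)    ≈⟨ *-cong (*-inverseʳ x≉0) (⁻¹^n*^n≈1 n x≉0) ⟩
    1# * 1#                              ≈⟨ *-identityʳ 1# ⟩
    1#                                   ∎

  -- A root of at most one would force its `K`-th power `x` to be at most one.
  root-≥1 : ∀ K .{{_ : NonZero K}} {x} → 1# < x → 1# ≤ root K x
  root-≥1 K {x} 1<x with total 1# (root K x)
  ... | inj₁ 1≤c = 1≤c
  ... | inj₂ c≤1 = contradiction (≤-antisym (proj₁ 1<x) x≤1) (proj₂ 1<x)
    where
    0<x : 0# < x
    0<x = <-≤-trans (0≤1 , 0≉1) (proj₁ 1<x)
    x≤1 : x ≤ 1#
    x≤1 = ≤-respˡ-≈ (root-^ K 0<x) (x≤1⇒x^n≤1 K (proj₁ (root-pos K 0<x)) c≤1)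

-- Sums over lists and over pairs of list elements

module ListSums {a ℓ₁ ℓ₂} (𝔽 : RootedOrderedField a ℓ₁ ℓ₂) where
  open RootedOrderedField 𝔽
  open OrderedFieldProperties 𝔽
  open Scheduling 𝔽
  open PosetReasoning poset
  open UMonoidMult (CommutativeRing.+-monoid commutativeRing) using (×-homo-+)

  fromℕ-nonNeg : ∀ n → 0# ≤ fromℕ n
  fromℕ-nonNeg ℕ.zero    = ≤-refl
  fromℕ-nonNeg (ℕ.suc n) = +-nonNeg 0≤1 (fromℕ-nonNeg n)

  fromℕ-+ : ∀ m n → fromℕ (m ℕ.+ n) ≈ fromℕ m + fromℕ n
  fromℕ-+ = ×-homo-+ 1#

  fromℕ-mono : ∀ {m n} → m ℕ.≤ n → fromℕ m ≤ fromℕ n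
  fromℕ-mono {n = n} ℕ.z≤n = fromℕ-nonNeg n
  fromℕ-mono (ℕ.s≤s m≤n)   = +-monoʳ-≤ 1# (fromℕ-mono m≤n)

  module _ {b} {A : Set b} where

    Σ : (A → Carrier) → List A → Carrier
    Σ f xs = sum (map f xs)

    Σ-cong : ∀ {f g} {xs} → All (λ x → f x ≈ g x) xs → Σ f xs ≈ Σ g xs
    Σ-cong []         = refl
    Σ-cong (eq ∷ eqs) = +-cong eq (Σ-cong eqs)

    Σ-mono : ∀ {f g} {xs} → All (λ x → f x ≤ g x) xs → Σ f xs ≤ Σ g xs
    Σ-mono []         = ≤-refl
    Σ-mono (le ∷ les) = +-mono-≤ le (Σ-mono les)

    Σ-+ : ∀ f g xs → Σ (λ x → f x + g x) xs ≈ Σ f xs + Σ g xs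
    Σ-+ f g []       = sym (+-identityʳ 0#)
    Σ-+ f g (x ∷ xs) = begin-equality
      f x + g x + Σ (λ x → f x + g x) xs  ≈⟨ +-congˡ (Σ-+ f g xs) ⟩
      f x + g x + (Σ f xs + Σ g xs)       ≈⟨ solve 4 (λ p q s t → p :+ q :+ (s :+ t) := p :+ s :+ (q :+ t))
                                               refl (f x) (g x) (Σ f xs) (Σ g xs) ⟩
      f x + Σ f xs + (g x + Σ g xs)       ∎

    Σ-* : ∀ k f xs → Σ (λ x → k * f x) xs ≈ k * Σ f xs
    Σ-* k f []       = sym (zeroʳ k)
    Σ-* k f (x ∷ xs) = trans (+-congˡ (Σ-* k f xs)) (sym (distribˡ k (f x) (Σ f xs)))

    Σ-const : ∀ k xs → Σ (λ _ → k) xs ≈ fromℕ (length xs) * k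
    Σ-const k []       = sym (zeroˡ k)
    Σ-const k (x ∷ xs) = begin-equality
      k + Σ (λ _ → k) xs               ≈⟨ +-cong (sym (*-identityˡ k)) (Σ-const k xs) ⟩
      1# * k + fromℕ (length xs) * k   ≈⟨ distribʳ k 1# (fromℕ (length xs)) ⟨
      (1# + fromℕ (length xs)) * k     ∎

    Σ-↭ : ∀ f {xs ys} → xs ↭ ys → Σ f xs ≈ Σ f ys
    Σ-↭ f ↭-refl                  = refl
    Σ-↭ f (prep x p)              = +-congˡ (Σ-↭ f p)
    Σ-↭ f (swap {xs} {ys} x y p)  = begin-equality
      f x + (f y + Σ f xs)  ≈⟨ +-congˡ (+-congˡ (Σ-↭ f p)) ⟩
      f x + (f y + Σ f ys)  ≈⟨ solve 3 (λ p q s → p :+ (q :+ s) := q :+ (p :+ s)) refl (f x) (f y) (Σ f ys) ⟩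
      f y + (f x + Σ f ys)  ∎
    Σ-↭ f (↭-trans p q)           = trans (Σ-↭ f p) (Σ-↭ f q)

    pairSum : (A → A → Carrier) → List A → Carrier
    pairSum g []       = 0#
    pairSum g (x ∷ xs) = Σ (g x) xs + pairSum g xs

    pairSum-↭ : ∀ {g} → (∀ x y → g x y ≈ g y x) → ∀ {xs ys} → xs ↭ ys → pairSum g xs ≈ pairSum g ys
    pairSum-↭ g-sym ↭-refl     = refl
    pairSum-↭ {g} g-sym (prep x p) = +-cong (Σ-↭ (g x) p) (pairSum-↭ g-sym p)
    pairSum-↭ {g} g-sym (swap {xs} {ys} x y p) = begin-equality
      g x y + Σ (g x) xs + (Σ (g y) xs + pairSum g xs)
        ≈⟨ +-cong (+-cong (g-sym x y) (Σ-↭ (g x) p)) (+-cong (Σ-↭ (g y) p) (pairSum-↭ g-sym p)) ⟩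
      g y x + Σ (g x) ys + (Σ (g y) ys + pairSum g ys)
        ≈⟨ solve 4 (λ k p q s → k :+ p :+ (q :+ s) := k :+ q :+ (p :+ s))
             refl (g y x) (Σ (g x) ys) (Σ (g y) ys) (pairSum g ys) ⟩
      g y x + Σ (g y) ys + (Σ (g x) ys + pairSum g ys) ∎
    pairSum-↭ g-sym (↭-trans p q) = trans (pairSum-↭ g-sym p) (pairSum-↭ g-sym q)

    pairSum-cong : ∀ {g h} → (∀ x y → g x y ≈ h x y) → ∀ xs → pairSum g xs ≈ pairSum h xs
    pairSum-cong g≈h []       = refl
    pairSum-cong g≈h (x ∷ xs) = +-cong (Σ-cong (All.universal (g≈h x) xs)) (pairSum-cong g≈h xs)

    pairSum-* : ∀ k g xs → pairSum (λ x y → k * g x y) xs ≈ k * pairSum g xs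
    pairSum-* k g []       = sym (zeroʳ k)
    pairSum-* k g (x ∷ xs) = trans (+-cong (Σ-* k (g x) xs) (pairSum-* k g xs)) (sym (distribˡ k _ _))

  module _ {b b′} {A : Set b} {B : Set b′} (f : A → B) where

    Σ-map : ∀ h xs → Σ h (map f xs) ≡ Σ (h ∘ f) xs
    Σ-map h xs = ≡.cong sum (≡.sym (Listₚ.map-∘ xs))

    pairSum-map : ∀ g xs → pairSum g (map f xs) ≡ pairSum (λ x y → g (f x) (f y)) xs
    pairSum-map g []       = ≡.refl
    pairSum-map g (x ∷ xs) = ≡.cong₂ _+_ (Σ-map (g (f x)) xs) (pairSum-map g xs)

  fromℕ-suc-pos : ∀ n → 0# < fromℕ (ℕ.suc n)
  fromℕ-suc-pos n = <-≤-trans (0≤1 , 0≉1) (≤-respˡ-≈ (+-identityʳ 1#) (+-monoʳ-≤ 1# (fromℕ-nonNeg n)))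

  sum-nonNeg : ∀ {xs} → All (0# ≤_) xs → 0# ≤ sum xs
  sum-nonNeg []           = ≤-refl
  sum-nonNeg (0≤x ∷ 0≤xs) = +-nonNeg 0≤x (sum-nonNeg 0≤xs)

  pairSum-⊓-nonNeg : ∀ {xs} → All (0# ≤_) xs → 0# ≤ pairSum _⊓_ xs
  pairSum-⊓-nonNeg []           = ≤-refl
  pairSum-⊓-nonNeg (0≤x ∷ 0≤xs) =
    +-nonNeg (sum-nonNeg (Allₚ.map⁺ (All.map (⊓-glb 0≤x) 0≤xs))) (pairSum-⊓-nonNeg 0≤xs)

  -- The weight of an entry counts the entry itself and its pairs with the later entries, in which
  -- it is the minimum.
  suffixWeighted-sorted : ∀ {xs} → AllPairs _≤_ xs → suffixWeighted xs ≈ sum xs + pairSum _⊓_ xs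
  suffixWeighted-sorted []                   = sym (+-identityʳ 0#)
  suffixWeighted-sorted {x ∷ xs} (x≤xs ∷ xs↗) = begin-equality
    (1# + fromℕ (length xs)) * x + suffixWeighted xs
      ≈⟨ +-congˡ (suffixWeighted-sorted xs↗) ⟩
    (1# + fromℕ (length xs)) * x + (sum xs + pairSum _⊓_ xs)
      ≈⟨ solve 4 (λ x n s p → (con (+ 1) :+ n) :* x :+ (s :+ p) := x :+ s :+ (n :* x :+ p))
           refl x (fromℕ (length xs)) (sum xs) (pairSum _⊓_ xs) ⟩
    x + sum xs + (fromℕ (length xs) * x + pairSum _⊓_ xs)
      ≈⟨ +-congˡ (+-congʳ (Σ-const x xs)) ⟨
    x + sum xs + (Σ (λ _ → x) xs + pairSum _⊓_ xs)
      ≈⟨ +-congˡ (+-congʳ (Σ-cong (All.map (sym ∘ x≤y⇒x⊓y≈x) x≤xs))) ⟩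
    x + sum xs + (Σ (x ⊓_) xs + pairSum _⊓_ xs) ∎

  sum-↭ : ∀ {xs ys} → xs ↭ ys → sum xs ≈ sum ys
  sum-↭ {xs} {ys} p = begin-equality
    sum xs      ≡⟨ ≡.cong sum (Listₚ.map-id xs) ⟨
    Σ id xs     ≈⟨ Σ-↭ id p ⟩
    Σ id ys     ≡⟨ ≡.cong sum (Listₚ.map-id ys) ⟩
    sum ys      ∎

  -- The right-hand side is invariant under permutation, so it may be evaluated on the sorted list.
  OPT-pairSum : ∀ xs → OPT xs ≈ sum xs + pairSum _⊓_ xs
  OPT-pairSum xs = begin-equality
    OPT xs                          ≈⟨ suffixWeighted-sorted (Sortedₚ.Sorted⇒AllPairs totalOrder (Sort.sort-↗ decTotalOrder xs)) ⟩
    sum ys + pairSum _⊓_ ys         ≈⟨ +-cong (sum-↭ ys↭xs) (pairSum-↭ ⊓-comm ys↭xs) ⟩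
    sum xs + pairSum _⊓_ xs         ∎
    where
    ys = Sort.sort decTotalOrder xs
    ys↭xs = Sort.sort-↭ decTotalOrder xs

  -- Twice a minimum is at most the sum of both entries, and each entry lies in `length xs - 1`
  -- pairs. This is the source of `m + 1` in `α`.
  pairSum-⊓-≤ : ∀ xs → (1# + 1#) * (sum xs + pairSum _⊓_ xs) ≤ (1# + fromℕ (length xs)) * sum xs
  pairSum-⊓-≤ []       = ≤-reflexive (solve 0
    ((con (+ 1) :+ con (+ 1)) :* (con (+ 0) :+ con (+ 0)) := (con (+ 1) :+ con (+ 0)) :* con (+ 0)) refl)
  pairSum-⊓-≤ (x ∷ xs) = begin
    (1# + 1#) * (x + s + (Σ (x ⊓_) xs + p))
      ≈⟨ solve 4 (λ x s q p → (con (+ 1) :+ con (+ 1)) :* (x :+ s :+ (q :+ p))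
            := x :+ x :+ (q :+ q) :+ (con (+ 1) :+ con (+ 1)) :* (s :+ p)) refl x s (Σ (x ⊓_) xs) p ⟩
    x + x + (Σ (x ⊓_) xs + Σ (x ⊓_) xs) + (1# + 1#) * (s + p)
      ≤⟨ +-mono-≤ (+-monoʳ-≤ (x + x) twice-⊓) (pairSum-⊓-≤ xs) ⟩
    x + x + (n * x + s) + (1# + n) * s
      ≈⟨ solve 3 (λ x s n → x :+ x :+ (n :* x :+ s) :+ (con (+ 1) :+ n) :* s
            := (con (+ 1) :+ (con (+ 1) :+ n)) :* (x :+ s)) refl x s n ⟩
    (1# + (1# + n)) * (x + s) ∎
    where
    s = sum xs
    p = pairSum _⊓_ xs
    n = fromℕ (length xs)
    twice-⊓ : Σ (x ⊓_) xs + Σ (x ⊓_) xs ≤ n * x + s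
    twice-⊓ = begin
      Σ (x ⊓_) xs + Σ (x ⊓_) xs  ≤⟨ +-mono-≤ (Σ-mono (All.universal (x⊓y≤x x) xs)) (Σ-mono (All.universal (x⊓y≤y x) xs)) ⟩
      Σ (λ _ → x) xs + Σ id xs   ≈⟨ +-cong (Σ-const x xs) (reflexive (≡.cong sum (Listₚ.map-id xs))) ⟩
      n * x + s                  ∎

  foldr-⊔-base : ∀ x ys → x ≤ foldr _⊔_ x ys
  foldr-⊔-base x []       = ≤-refl
  foldr-⊔-base x (y ∷ ys) = ≤-trans (foldr-⊔-base x ys) (x≤y⊔x y _)

  foldr-⊔-applyUpTo : ∀ x f {k i} → i ℕ.< k → f i ≤ foldr _⊔_ x (applyUpTo f k)
  foldr-⊔-applyUpTo x f {ℕ.suc k} {ℕ.zero}  _           = x≤x⊔y (f 0) _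
  foldr-⊔-applyUpTo x f {ℕ.suc k} {ℕ.suc i} (ℕ.s≤s i<k) =
    ≤-trans (foldr-⊔-applyUpTo x (f ∘ ℕ.suc) i<k) (x≤y⊔x (f 0) _)

  -- The cases follow the encoding of `β`: the term for `q = 1` is the base of the fold, the others
  -- are its list entries.
  βterm≤β : ∀ K D i → ℕ.suc i ℕ.< K → βterm D K (ℕ.suc i) ≤ β K D
  βterm≤β (ℕ.suc (ℕ.suc k)) D ℕ.zero    _                   =
    foldr-⊔-base _ (applyUpTo (λ i → βterm D (ℕ.suc (ℕ.suc k)) (2 ℕ.+ i)) k)
  βterm≤β (ℕ.suc (ℕ.suc k)) D (ℕ.suc i) (ℕ.s≤s (ℕ.s≤s i<k)) = foldr-⊔-applyUpTo _ _ i<k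
  βterm≤β (ℕ.suc ℕ.zero)    D i         (ℕ.s≤s ())

  β-nonNeg : ∀ K .{{_ : NonZero K}} D → 0# < D → 0# ≤ β K D
  β-nonNeg (ℕ.suc ℕ.zero)      D 0<D = ≤-refl
  β-nonNeg K@(ℕ.suc (ℕ.suc k)) D 0<D = ≤-trans
    (*-nonNeg (fromℕ-nonNeg 1) (^-nonNeg 1 (⁻¹-nonNeg (root-pos K 0<D))))
    (βterm≤β K D 0 (ℕ.s≤s (ℕ.s≤s ℕ.z≤n)))

-- The geometric fallback

module FallbackBounds {a ℓ₁ ℓ₂} (𝔽 : RootedOrderedField a ℓ₁ ℓ₂)
  (I : Scheduling.Instance 𝔽) (tr : Scheduling.Trigger 𝔽 I) where
  open RootedOrderedField 𝔽
  open OrderedFieldProperties 𝔽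
  open ListSums 𝔽
  open Scheduling 𝔽
  open Instance I
  open Fallback I tr
  open Trigger tr
  open PosetReasoning poset

  -- Completion times and survivors of a round

  completion : Carrier → List (Phase I) → Job I → Carrier
  completion = completionTime I

  completion-other : ∀ t ph phs {j} → ¬ (Phase.job ph ≡ j) →
    completion t (ph ∷ phs) j ≡ completion (t + Phase.amount ph) phs j
  completion-other t ph phs {j} ph≢j with Phase.job ph Finₚ.≟ j
  ... | yes ph≡j = contradiction ph≡j ph≢j
  ... | no  _    = ≡.refl

  completion-unfinished : ∀ t i d phs j →
    completion t (phase i d false ∷ phs) j ≡ completion (t + d) phs j
  completion-unfinished t i d phs j with i Finₚ.≟ j
  ... | yes _ = ≡.refl
  ... | no  _ = ≡.refl

  completion-finished : ∀ t j d phs → completion t (phase j d true ∷ phs) j ≡ t + d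
  completion-finished t j d phs with j Finₚ.≟ j
  ... | yes _   = ≡.refl
  ... | no  j≢j = contradiction ≡.refl j≢j

  size : Active → Carrier
  size (j , _) = r j

  work : Carrier → List Active → List (Phase I) → Carrier
  work t as phs = Σ (λ a → completion t phs (proj₁ a)) as

  -- At fallback entry `T` is zero; between rounds it is the last threshold that the job has
  -- survived.
  Served : Carrier → Active → Set ℓ₂
  Served T a = proj₂ a ≤ T × T ≤ size a

  Distinct : Active → Active → Set
  Distinct a b = ¬ (proj₁ a ≡ proj₁ b)

  -- Guarantees that no job is left when the thresholds run out, so the default value of
  -- `completionTime` never enters a bound.
  Covered : List Carrier → Active → Set (a Level.⊔ ℓ₂)
  Covered Ts a = Any (size a ≤_) Ts

  survivors-All : ∀ {ℓ} {P : Active → Set ℓ} T {as} →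
    All (λ a → ¬ (size a ≤ T) → P (proj₁ a , T)) as → All P (survivors T as)
  survivors-All T []                       = []
  survivors-All T {(j , _) ∷ _} (pa ∷ pas) with r j ≤? T
  ... | yes _    = survivors-All T pas
  ... | no  rj≰T = pa rj≰T ∷ survivors-All T pas

  survivors-covered : ∀ {T Ts as} → All (Covered (T ∷ Ts)) as → All (Covered Ts) (survivors T as)
  survivors-covered {T} = survivors-All T ∘ All.map λ where
    (here  r≤T)  r≰T → contradiction r≤T r≰T
    (there r≤Ts) _   → r≤Ts

  survivors-distinct : ∀ {T as} → AllPairs Distinct as → AllPairs Distinct (survivors T as)
  survivors-distinct = AllPairsₚ.map⁺ ∘ AllPairsₚ.filter⁺ _

  covered-[] : ∀ {as} → All (Covered []) as → as ≡ []
  covered-[] []       = ≡.refl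
  covered-[] (() ∷ _)

  -- The budget, a potential for the total completion time

  module _ (c : Carrier) (1≤c : 1# ≤ c) (0≤r : ∀ j → 0# ≤ r j) where

    0≤c : 0# ≤ c
    0≤c = ≤-trans 0≤1 1≤c

    x≤c*x : ∀ {x} → 0# ≤ x → x ≤ c * x
    x≤c*x {x} 0≤x = ≤-respˡ-≈ (*-identityˡ x) (*-monoʳ-nonNeg 0≤x 1≤c)

    -- Here `p` is the size of the completing job, and `x` and `q` are the service and the size of
    -- another one. Whichever of `p` and `q` is the minimum, one of the two services `x` and `p` is
    -- at most that minimum and the other at most `c` times it.
    ⊓-delay : ∀ {x p q} → x ≤ c * p → x ≤ q → p ≤ c * q → x + p ≤ (1# + c) * (p ⊓ q)
    ⊓-delay {x} {p} {q} x≤cp x≤q p≤cq with ⊓-sel p q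
    ... | inj₁ p⊓q≈p = begin
      x + p               ≤⟨ +-monoˡ-≤ p x≤cp ⟩
      c * p + p           ≈⟨ solve 2 (λ c p → c :* p :+ p := (con (+ 1) :+ c) :* p) refl c p ⟩
      (1# + c) * p        ≈⟨ *-congˡ p⊓q≈p ⟨
      (1# + c) * (p ⊓ q)  ∎
    ... | inj₂ p⊓q≈q = begin
      x + p               ≤⟨ +-mono-≤ x≤q p≤cq ⟩
      q + c * q           ≈⟨ solve 2 (λ c q → q :+ c :* q := (con (+ 1) :+ c) :* q) refl c q ⟩
      (1# + c) * q        ≈⟨ *-congˡ p⊓q≈q ⟨
      (1# + c) * (p ⊓ q)  ∎

    -- Each pair of jobs is allowed a total mutual delay of (1 + c) times its
    -- smaller size; the service already given to either job has used up part
    -- of that allowance.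
    allowance : Active → Active → Carrier
    allowance a b = (1# + c) * (size a ⊓ size b) - (proj₂ a + proj₂ b)

    -- The first sum lets every job run alone from time `t`; the pair terms have to pay for all
    -- delays.
    budget : Carrier → List Active → Carrier
    budget t as = Σ (λ a → t + (size a - proj₂ a)) as + pairSum allowance as

    allowance-sym : ∀ a b → allowance a b ≈ allowance b a
    allowance-sym a b = +-cong (*-congˡ (⊓-comm (size a) (size b))) (-‿cong (+-comm (proj₂ a) (proj₂ b)))

    -- Isolates everything that depends on `a` by folding its allowances into the terms of the other
    -- jobs, so that both updates below are compared term by term.
    budget-extract : ∀ t pre a as → budget t (pre ++ a ∷ as) ≈
      (t + (size a - proj₂ a)) + (Σ (λ b → (t + (size b - proj₂ b)) + allowance a b) (pre ++ as)
                                  + pairSum allowance (pre ++ as))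
    budget-extract t pre a as = begin-equality
      Σ f (pre ++ a ∷ as) + pairSum allowance (pre ++ a ∷ as)
        ≈⟨ +-cong (Σ-↭ f (shift a pre as)) (pairSum-↭ allowance-sym (shift a pre as)) ⟩
      (f a + Σ f os) + (Σ (allowance a) os + pairSum allowance os)
        ≈⟨ solve 4 (λ w x y z → (w :+ x) :+ (y :+ z) := w :+ ((x :+ y) :+ z)) refl
             (f a) (Σ f os) (Σ (allowance a) os) (pairSum allowance os) ⟩
      f a + ((Σ f os + Σ (allowance a) os) + pairSum allowance os)
        ≈⟨ +-congˡ (+-congʳ (Σ-+ f (allowance a) os)) ⟨
      f a + (Σ (λ b → f b + allowance a b) os + pairSum allowance os) ∎
      where
      f = λ b → t + (size b - proj₂ b)
      os = pre ++ as

    -- An exact invariant: the time advances by `T - x`, which the served job recovers from its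
    -- missing service and every other job from its allowance with the served one.
    budget-serve : ∀ t j x T pre as →
      budget (t + (T - x)) (pre ++ (j , T) ∷ as) ≈ budget t (pre ++ (j , x) ∷ as)
    budget-serve t j x T pre as = begin-equality
      budget t′ (pre ++ (j , T) ∷ as)
        ≈⟨ budget-extract t′ pre (j , T) as ⟩
      (t′ + (r j - T)) + (Σ (λ b → (t′ + (size b - proj₂ b)) + allowance (j , T) b) os + pairSum allowance os)
        ≈⟨ +-cong (solve 4 (λ t T x p → (t :+ (T :- x)) :+ (p :- T) := t :+ (p :- x)) refl t T x (r j))
             (+-congʳ (Σ-cong (All.universal shift-allowance os))) ⟩
      (t + (r j - x)) + (Σ (λ b → (t + (size b - proj₂ b)) + allowance (j , x) b) os + pairSum allowance os)
        ≈⟨ budget-extract t pre (j , x) as ⟨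
      budget t (pre ++ (j , x) ∷ as) ∎
      where
      t′ = t + (T - x)
      os = pre ++ as
      shift-allowance : ∀ b → (t′ + (size b - proj₂ b)) + allowance (j , T) b
                            ≈ (t + (size b - proj₂ b)) + allowance (j , x) b
      shift-allowance b = solve 6
        (λ t T x q y m → (t :+ (T :- x) :+ (q :- y)) :+ (m :- (T :+ y)) := (t :+ (q :- y)) :+ (m :- (x :+ y)))
        refl t T x (size b) (proj₂ b) ((1# + c) * (r j ⊓ size b))

    -- The term of the completing job is exactly its completion time. Every other job is delayed by
    -- `r j - x`, which by hypothesis its allowance with `j` still covers; the rest of that
    -- allowance is dropped.
    budget-complete : ∀ t j x pre as →
      All (λ b → proj₂ b + r j ≤ (1# + c) * (r j ⊓ size b)) (pre ++ as) →
      (t + (r j - x)) + budget (t + (r j - x)) (pre ++ as) ≤ budget t (pre ++ (j , x) ∷ as)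
    budget-complete t j x pre as fits = begin
      t′ + (Σ (λ b → t′ + (size b - proj₂ b)) os + pairSum allowance os)
        ≤⟨ +-monoʳ-≤ t′ (+-monoˡ-≤ _ (Σ-mono (All.map (λ {b} → absorb b) fits))) ⟩
      t′ + (Σ (λ b → (t + (size b - proj₂ b)) + allowance (j , x) b) os + pairSum allowance os)
        ≈⟨ budget-extract t pre (j , x) as ⟨
      budget t (pre ++ (j , x) ∷ as) ∎
      where
      t′ = t + (r j - x)
      os = pre ++ as
      absorb : ∀ b → proj₂ b + r j ≤ (1# + c) * (r j ⊓ size b) →
        t′ + (size b - proj₂ b) ≤ (t + (size b - proj₂ b)) + allowance (j , x) b
      absorb b fit = 0≤y-x⇒x≤y (≤-respʳ-≈
        (solve 6 (λ t p x q y m → m :- (y :+ p)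
                    := (t :+ (q :- y)) :+ (m :- (x :+ y)) :- (t :+ (p :- x) :+ (q :- y)))
          refl t (r j) x (size b) (proj₂ b) ((1# + c) * (r j ⊓ size b)))
        (x≤y⇒0≤y-x fit))

    -- One-sided on purpose: the condition falls on the later job, so the head of the list may be
    -- arbitrarily small.
    Precedes : Carrier → Active → Active → Set ℓ₂
    Precedes T a b = Distinct a b × T ≤ c * size b

    WithinBudget : Carrier → List Active → List (Phase I) → Set ℓ₂
    WithinBudget t as phs = work t as phs ≤ budget t as

    -- pre lists the jobs that the current round has already served without
    -- completing them.
    round-withinBudget : ∀ {T x phs} pre as t → All (Served T) pre → All (Served x) as →
      All (λ a → All (Precedes T a) as) pre → AllPairs (Precedes T) as →
      (∀ t → WithinBudget t (pre ++ survivors T as) phs) →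
      WithinBudget t (pre ++ as) (map (serve T) as ++ phs)
    round-withinBudget pre [] t _ _ _ _ rest = rest t
    round-withinBudget {T} {phs = phs} pre ((j , x) ∷ as) t preT ((_ , x≤rj) ∷ asx) pre-as (j-as ∷ as-as) rest
      with r j ≤? T
    ... | yes rj≤T = begin
      work t (pre ++ (j , x) ∷ as) (ph ∷ phs′)
        ≈⟨ Σ-↭ _ (shift (j , x) pre as) ⟩
      completion t (ph ∷ phs′) j + work t (pre ++ as) (ph ∷ phs′)
        ≈⟨ +-cong (reflexive (completion-finished t j d phs′))
             (Σ-cong (All.map (λ j≢b → reflexive (completion-other t ph phs′ j≢b)) j-others)) ⟩
      (t + d) + work (t + d) (pre ++ as) phs′
        ≤⟨ +-monoʳ-≤ (t + d) (round-withinBudget pre as (t + d) preT asx (All.map All.tail pre-as) as-as rest) ⟩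
      (t + d) + budget (t + d) (pre ++ as)
        ≤⟨ budget-complete t j x pre as (Allₚ.++⁺ pre-fits as-fits) ⟩
      budget t (pre ++ (j , x) ∷ as) ∎
      where
      d = r j - x
      ph = phase j d true
      phs′ = map (serve T) as ++ phs
      j-others : All (λ b → ¬ (j ≡ proj₁ b)) (pre ++ as)
      j-others = Allₚ.++⁺ (All.map (λ b-as → proj₁ (All.head b-as) ∘ ≡.sym) pre-as) (All.map proj₁ j-as)
      -- A job of `pre` has survived `T`, so its size is at least `T`, and its service of at most
      -- `T` is at most `c * r j` because `j` comes later.
      pre-fits : All (λ b → proj₂ b + r j ≤ (1# + c) * (r j ⊓ size b)) pre
      pre-fits = All.zipWith (λ {b} ((y≤T , T≤rb) , b-as) → ⊓-delay
          (≤-trans y≤T (proj₂ (All.head b-as)))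
          (≤-trans y≤T T≤rb)
          (≤-trans rj≤T (≤-trans T≤rb (x≤c*x (0≤r (proj₁ b))))))
        (preT , pre-as)
      -- A job of `as` still has only the service of earlier rounds, bounded by a level that both
      -- jobs have survived; since it comes after `j`, `T` is at most `c` times its size.
      as-fits : All (λ b → proj₂ b + r j ≤ (1# + c) * (r j ⊓ size b)) as
      as-fits = All.zipWith (λ ((y≤x , x≤rb) , (_ , T≤crb)) → ⊓-delay
          (≤-trans y≤x (≤-trans x≤rj (x≤c*x (0≤r j))))
          (≤-trans y≤x x≤rb)
          (≤-trans rj≤T T≤crb))
        (asx , j-as)
    ... | no rj≰T = begin
      work t (pre ++ (j , x) ∷ as) (phase j d false ∷ phs′)
        ≈⟨ Σ-cong (All.universal (λ b → reflexive (completion-unfinished t j d phs′ (proj₁ b))) (pre ++ (j , x) ∷ as)) ⟩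
      work (t + d) (pre ++ (j , x) ∷ as) phs′
        ≈⟨ trans (Σ-↭ _ (shift (j , x) pre as)) (sym (Σ-↭ _ (shift (j , T) pre as))) ⟩
      work (t + d) (pre ++ (j , T) ∷ as) phs′
        ≤⟨ ≡.subst (λ bs → WithinBudget (t + d) bs phs′) (Listₚ.∷ʳ-++ pre (j , T) as) served ⟩
      budget (t + d) (pre ++ (j , T) ∷ as)
        ≈⟨ budget-serve t j x T pre as ⟩
      budget t (pre ++ (j , x) ∷ as) ∎
      where
      d = T - x
      phs′ = map (serve T) as ++ phs
      served : WithinBudget (t + d) ((pre ∷ʳ (j , T)) ++ as) phs′
      served = round-withinBudget (pre ∷ʳ (j , T)) as (t + d)
        (Allₚ.∷ʳ⁺ preT (≤-refl , ≰⇒≥ rj≰T)) asx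
        (Allₚ.∷ʳ⁺ (All.map All.tail pre-as) j-as) as-as
        (λ t → ≡.subst (λ bs → WithinBudget t bs phs) (≡.sym (Listₚ.∷ʳ-++ pre (j , T) (survivors T as))) (rest t))

    -- A survivor has size at least `T`, and `T′ ≤ c * T`, so in the next round the size condition
    -- holds for all survivors, the head included.
    rounds-withinBudget : ∀ {T x} Ts as t → Linked (λ T T′ → T′ ≤ c * T) (T ∷ Ts) →
      All (Served x) as → AllPairs (Precedes T) as → All (Covered (T ∷ Ts)) as →
      WithinBudget t as (rounds (T ∷ Ts) as)
    rounds-withinBudget {T} [] as t _ asx as-as covered =
      round-withinBudget [] as t [] asx [] as-as (λ t → ≡.subst (λ bs → WithinBudget t bs [])
        (≡.sym (covered-[] (survivors-covered covered))) (≤-reflexive (sym (+-identityʳ 0#))))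
    rounds-withinBudget {T} (T′ ∷ Ts) as t (T′≤cT ∷ growth) asx as-as covered =
      round-withinBudget [] as t [] asx [] as-as (λ t →
        rounds-withinBudget Ts (survivors T as) t growth
          (survivors-All T (All.universal (λ _ r≰T → ≤-refl , ≰⇒≥ r≰T) as))
          (AllPairs.zip (survivors-distinct (AllPairs.map proj₁ as-as) ,
                         all⇒allPairs (survivors-All T (All.universal
                           (λ _ r≰T → ≤-trans T′≤cT (*-monoˡ-nonNeg 0≤c (≰⇒≥ r≰T))) as))))
          (survivors-covered covered))
      where
      all⇒allPairs : ∀ {bs} → All (λ b → T′ ≤ c * size b) bs → AllPairs (λ _ b → T′ ≤ c * size b) bs
      all⇒allPairs []       = []
      all⇒allPairs (p ∷ ps) = AllPairs-from-All (λ _ q → q) _ ps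

    budget-initial : ∀ t js → budget t (map (λ j → j , 0#) js) ≈
      Σ (λ _ → t) js + (sum (map r js) + (1# + c) * pairSum _⊓_ (map r js))
    budget-initial t js = begin-equality
      Σ (λ a → t + (size a - proj₂ a)) as + pairSum allowance as
        ≡⟨ ≡.cong₂ _+_ (Σ-map _ _ js) (pairSum-map _ _ js) ⟩
      Σ (λ j → t + (r j - 0#)) js + pairSum (λ i j → allowance (i , 0#) (j , 0#)) js
        ≈⟨ +-cong (trans (Σ-cong (All.universal (λ j → solve 2 (λ t p → t :+ (p :- con (+ 0)) := t :+ p) refl t (r j)) js))
                         (Σ-+ _ r js))
             (trans (pairSum-cong (λ i j → solve 1 (λ m → m :- (con (+ 0) :+ con (+ 0)) := m) refl _) js)
                    (pairSum-* _ _ js)) ⟩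
      (Σ (λ _ → t) js + sum (map r js)) + (1# + c) * pairSum (λ i j → r i ⊓ r j) js
        ≈⟨ +-assoc _ _ _ ⟩
      Σ (λ _ → t) js + (sum (map r js) + (1# + c) * pairSum (λ i j → r i ⊓ r j) js)
        ≡⟨ ≡.cong (λ m → Σ (λ _ → t) js + (sum (map r js) + (1# + c) * m)) (pairSum-map r _⊓_ js) ⟨
      Σ (λ _ → t) js + (sum (map r js) + (1# + c) * pairSum _⊓_ (map r js)) ∎
      where as = map (λ j → j , 0#) js

  Σ-completion-offset : ∀ t phs js → Σ (λ j → completion t phs j - t) js + Σ (λ _ → t) js ≈ Σ (completion t phs) js
  Σ-completion-offset t phs js = begin-equality
    Σ (λ j → completion t phs j - t) js + Σ (λ _ → t) js  ≈⟨ Σ-+ _ _ js ⟨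
    Σ (λ j → completion t phs j - t + t) js
      ≈⟨ Σ-cong (All.universal (λ j → solve 2 (λ x t → x :- t :+ t := x) refl (completion t phs j) t) js) ⟩
    Σ (completion t phs) js                               ∎

  threshold : ℕ → ℕ → Carrier
  threshold K h = s₀ * root K D ^ (h ℕ.+ 1)

  -- Interruptions

  incomplete : List (Phase I) → ℕ
  incomplete []         = 0
  incomplete (ph ∷ phs) = (if Phase.completes ph then 0 else 1) ℕ.+ incomplete phs

  -- Only an unfinished phase can be followed by a charge, and merging consecutive phases of one job
  -- only lowers the count.
  interruptions≤incomplete : ∀ ph phs → interruptions I ph phs ℕ.≤ incomplete (ph ∷ phs)
  interruptions≤incomplete ph []         = ℕ.z≤n
  interruptions≤incomplete ph (ph′ ∷ phs) = ℕₚ.+-mono-≤ charge≤ (interruptions≤incomplete ph′ phs)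
    where
    charge≤ : charge I ph ph′ ℕ.≤ (if Phase.completes ph then 0 else 1)
    charge≤ with Phase.completes ph | does (Phase.job ph Finₚ.≟ Phase.job ph′)
    ... | true  | _     = ℕ.z≤n
    ... | false | true  = ℕ.z≤n
    ... | false | false = ℕₚ.≤-refl

  charge-same-job : ∀ ph ph′ → Phase.job ph ≡ Phase.job ph′ → charge I ph ph′ ≡ 0
  charge-same-job ph ph′ same with Phase.completes ph | Phase.job ph Finₚ.≟ Phase.job ph′
  ... | true  | _        = ≡.refl
  ... | false | yes _    = ≡.refl
  ... | false | no differ = contradiction same differ

  job-serve : ∀ T a → Phase.job (serve T a) ≡ proj₁ a
  job-serve T (j , x) with does (r j ≤? T)
  ... | true  = ≡.refl
  ... | false = ≡.refl

  -- The phase before fallback entry is unfinished too, but its charge vanishes because the fallback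
  -- starts with the same job `e`.
  Pres≤incomplete : ∀ K .{{_ : NonZero K}} → Pres K ℕ.≤ incomplete (G K)
  Pres≤incomplete (ℕ.suc k) = ≡.subst (λ n → n ℕ.+ interruptions I first others ℕ.≤ incomplete (first ∷ others))
    (≡.sym (charge-same-job (phase e (u e) false) first (≡.sym (job-serve _ (e , 0#)))))
    (interruptions≤incomplete first others)
    where
    T₀ = threshold (ℕ.suc k) 0
    Ts = applyUpTo (threshold (ℕ.suc k) ∘ ℕ.suc) k
    as = map (λ j → j , 0#) later
    first = serve T₀ (e , 0#)
    others = map (serve T₀) as ++ rounds Ts (survivors T₀ ((e , 0#) ∷ as))

  incomplete-round : ∀ T as phs →
    incomplete (map (serve T) as ++ phs) ≡ length (survivors T as) ℕ.+ incomplete phs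
  incomplete-round T []             phs = ≡.refl
  incomplete-round T ((j , x) ∷ as) phs with r j ≤? T
  ... | yes _ = incomplete-round T as phs
  ... | no  _ = ≡.cong ℕ.suc (incomplete-round T as phs)

  module _ (b : Carrier) where

    -- A job that enters its (h + 1)-st round has been interrupted h times and
    -- pays for this with b times its size.
    survivors-charge : ∀ h T as → All (λ a → fromℕ h ≤ b * size a) as →
      Σ (λ _ → fromℕ h) as + fromℕ (length (survivors T as)) + Σ (λ a → b * size a) (survivors T as)
        ≤ Σ (λ a → b * size a) as + Σ (λ _ → fromℕ (ℕ.suc h)) (survivors T as)
    survivors-charge h T []             []         = ≤-reflexive (+-congʳ (+-identityʳ 0#))
    survivors-charge h T ((j , x) ∷ as) (paid ∷ paids) with r j ≤? T
    ... | yes _ = begin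
      H + N + L + B           ≈⟨ solve 4 (λ H N L B → H :+ N :+ L :+ B := H :+ (N :+ L :+ B)) refl H N L B ⟩
      H + (N + L + B)         ≤⟨ +-mono-≤ paid (survivors-charge h T as paids) ⟩
      b * r j + (R + M)       ≈⟨ +-assoc (b * r j) R M ⟨
      b * r j + R + M         ∎
      where
      H = fromℕ h
      N = Σ (λ _ → fromℕ h) as
      L = fromℕ (length (survivors T as))
      B = Σ (λ a → b * size a) (survivors T as)
      R = Σ (λ a → b * size a) as
      M = Σ (λ _ → fromℕ (ℕ.suc h)) (survivors T as)
    ... | no _ = begin
      H + N + (1# + L) + (b * r j + B)
        ≈⟨ solve 5 (λ H N L B k → H :+ N :+ (con (+ 1) :+ L) :+ (k :+ B) := (con (+ 1) :+ H) :+ k :+ (N :+ L :+ B))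
             refl H N L B (b * r j) ⟩
      (1# + H) + b * r j + (N + L + B)
        ≤⟨ +-monoʳ-≤ _ (survivors-charge h T as paids) ⟩
      (1# + H) + b * r j + (R + M)
        ≈⟨ solve 4 (λ H k R M → (con (+ 1) :+ H) :+ k :+ (R :+ M) := k :+ R :+ ((con (+ 1) :+ H) :+ M))
             refl H (b * r j) R M ⟩
      b * r j + R + ((1# + H) + M) ∎
      where
      H = fromℕ h
      N = Σ (λ _ → fromℕ h) as
      L = fromℕ (length (survivors T as))
      B = Σ (λ a → b * size a) (survivors T as)
      R = Σ (λ a → b * size a) as
      M = Σ (λ _ → fromℕ (ℕ.suc h)) (survivors T as)

    -- With `h` unfinished phases behind it, a job that survives `f i` has `h + i + 1` of them, and
    -- its size exceeds `f i`. The prices stop before the last threshold, which nothing survives.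
    rounds-charge : 0# ≤ b → ∀ k f h as → (∀ i → ℕ.suc i ℕ.< k → fromℕ (ℕ.suc (h ℕ.+ i)) ≤ b * f i) →
      All (λ a → fromℕ h ≤ b * size a) as → All (Covered (applyUpTo f k)) as →
      Σ (λ _ → fromℕ h) as + fromℕ (incomplete (rounds (applyUpTo f k) as)) ≤ Σ (λ a → b * size a) as
    rounds-charge 0≤b ℕ.zero f h as prices paid covered with covered-[] covered
    ... | ≡.refl = ≤-reflexive (+-identityʳ 0#)
    rounds-charge 0≤b (ℕ.suc k) f h as prices paid covered = 0≤y-x⇒x≤y (≤-respʳ-≈
      (trans (solve 6 (λ N L B R M i → (R :+ M :- (N :+ L :+ B)) :+ (B :- (M :+ i)) := R :- (N :+ (L :+ i)))
        refl N L B R M (fromℕ i))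
        (+-congˡ (-‿cong (+-congˡ (sym (trans
          (reflexive (≡.cong fromℕ (incomplete-round (f 0) as (rounds (applyUpTo (f ∘ ℕ.suc) k) S))))
          (fromℕ-+ (length S) i)))))))
      -- The slack of the claim is the slack of this round plus that of the remaining rounds; `B`
      -- and `M` cancel.
      (+-nonNeg (x≤y⇒0≤y-x (survivors-charge h (f 0) as paid))
        (x≤y⇒0≤y-x (rounds-charge 0≤b k (f ∘ ℕ.suc) (ℕ.suc h) S
          (λ i i<k → ≤-respˡ-≈ (reflexive (≡.cong (fromℕ ∘ ℕ.suc) (ℕₚ.+-suc h i))) (prices (ℕ.suc i) (ℕ.s≤s i<k)))
          (survivors-paid k ≡.refl)
          S-covered))))
      where
      S = survivors (f 0) as
      i = incomplete (rounds (applyUpTo (f ∘ ℕ.suc) k) S)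
      N = Σ (λ _ → fromℕ h) as
      L = fromℕ (length S)
      B = Σ (λ a → b * size a) S
      R = Σ (λ a → b * size a) as
      M = Σ (λ _ → fromℕ (ℕ.suc h)) S
      S-covered : All (Covered (applyUpTo (f ∘ ℕ.suc) k)) S
      S-covered = survivors-covered covered
      -- The copy `k′` of `k` allows a case split here: after the last round there is no price, but
      -- also no survivor.
      survivors-paid : ∀ k′ → k ≡ k′ → All (λ a → fromℕ (ℕ.suc h) ≤ b * size a) S
      survivors-paid ℕ.zero     ≡.refl = ≡.subst (All _) (≡.sym (covered-[] S-covered)) []
      survivors-paid (ℕ.suc k′) ≡.refl = survivors-All (f 0) (All.universal (λ _ r≰T → ≤-trans
        (≤-respˡ-≈ (reflexive (≡.cong (fromℕ ∘ ℕ.suc) (ℕₚ.+-identityʳ h))) (prices 0 (ℕ.s≤s (ℕ.s≤s ℕ.z≤n))))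
        (*-monoˡ-nonNeg 0≤b (≰⇒≥ r≰T))) as)

  -- Nonpreemptive service in a single round

  Σ-completion-nonpreemptive : ∀ t js → AllPairs (λ i j → ¬ (i ≡ j)) js →
    Σ (completion t (map (λ j → phase j (r j - 0#) true) js)) js
      ≈ Σ (λ _ → t) js + suffixWeighted (map r js)
  Σ-completion-nonpreemptive t []       []                   = sym (+-identityʳ 0#)
  Σ-completion-nonpreemptive t (j ∷ js) (j∉js ∷ distinct) = begin-equality
    completion t (ph ∷ phs) j + Σ (completion t (ph ∷ phs)) js
      ≈⟨ +-cong (reflexive (completion-finished t j d phs))
           (Σ-cong (All.map (λ j≢i → reflexive (completion-other t ph phs j≢i)) j∉js)) ⟩
    (t + d) + Σ (completion (t + d) phs) js
      ≈⟨ +-congˡ (trans (Σ-completion-nonpreemptive (t + d) js distinct) (+-congʳ (Σ-const (t + d) js))) ⟩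
    (t + d) + (N * (t + d) + W)
      ≈⟨ solve 4 (λ t p N W → (t :+ (p :- con (+ 0))) :+ (N :* (t :+ (p :- con (+ 0))) :+ W)
                    := (t :+ N :* t) :+ ((con (+ 1) :+ N) :* p :+ W)) refl t (r j) N W ⟩
    (t + N * t) + ((1# + N) * r j + W)
      ≈⟨ +-cong (+-congˡ (Σ-const t js)) (+-congʳ (*-congʳ (+-congˡ (reflexive (≡.cong fromℕ (Listₚ.length-map r js)))))) ⟨
    (t + Σ (λ _ → t) js) + ((1# + fromℕ (length (map r js))) * r j + W) ∎
    where
    d = r j - 0#
    ph = phase j d true
    phs = map (λ i → phase i (r i - 0#) true) js
    N = fromℕ (length js)
    W = suffixWeighted (map r js)

  incomplete-nonpreemptive : ∀ (amount : Job I → Carrier) js → incomplete (map (λ j → phase j (amount j) true) js) ≡ 0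
  incomplete-nonpreemptive amount []       = ≡.refl
  incomplete-nonpreemptive amount (j ∷ js) = incomplete-nonpreemptive amount js

  -- Keeping the amount `r j - 0#` as `serve` computes it makes this an equation up to `≡`, along
  -- which statements about phase lists can be transported.
  single-round : ∀ T js → All (λ j → r j ≤ T) js →
    rounds (T ∷ []) (map (λ j → j , 0#) js) ≡ map (λ j → phase j (r j - 0#) true) js
  single-round T js fits = ≡.trans (Listₚ.++-identityʳ _) (≡.trans (≡.sym (Listₚ.map-∘ js))
    (Listₚ.map-cong-local (All.map serve-all fits)))
    where
    serve-all : ∀ {j} → r j ≤ T → serve T (j , 0#) ≡ phase j (r j - 0#) true
    serve-all {j} rj≤T with r j ≤? T
    ... | yes _    = ≡.refl
    ... | no  rj≰T = contradiction rj≤T rj≰T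

  s₀*D≈s₁ : s₀ * D ≈ s₁
  s₀*D≈s₁ = *-inverse-cancelˡ (0<⇒≉0 0<s₀) s₁

  -- The delay bound `S + (1# + c) * M` equals `(1# + c) * O - c * S` for `O = S + M`. Inserting the
  -- lower bound `2 O / (k + 1)` for `S` yields exactly `α k c * O`; the slack is that of the
  -- hypothesis times `c / (k + 1)`.
  OPT-fraction : ∀ {c S O} k → 0# ≤ c → (1# + 1#) * O ≤ (1# + fromℕ k) * S →
    ((1# + c) * O - c * S) ≤ α k c * O
  OPT-fraction {c} {S} {O} k 0≤c 2O≤wS = 0≤y-x⇒x≤y (≤-respʳ-≈ identity
    (*-nonNeg (*-nonNeg 0≤c (⁻¹-nonNeg w-pos)) (x≤y⇒0≤y-x 2O≤wS)))
    where
    w = fromℕ (k ℕ.+ 1)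
    w≡ : w ≡ fromℕ (ℕ.suc k)
    w≡ = ≡.cong fromℕ (ℕₚ.+-comm k 1)
    w-pos : 0# < w
    w-pos = ≡.subst (0# <_) (≡.sym w≡) (fromℕ-suc-pos k)
    identity : c * w ⁻¹ * ((1# + fromℕ k) * S - (1# + 1#) * O) ≈ α k c * O - ((1# + c) * O - c * S)
    identity = begin-equality
      c * w ⁻¹ * ((1# + fromℕ k) * S - (1# + 1#) * O)
        ≡⟨ ≡.cong (λ v → c * w ⁻¹ * (v * S - (1# + 1#) * O)) w≡ ⟨
      c * w ⁻¹ * (w * S - (1# + 1#) * O)
        -- `fromℕ 2` unfolds to `1# + (1# + 0#)`, and the coefficient is spelled to match.
        ≈⟨ solve 5 (λ c i w S O → c :* i :* (w :* S :- (con (+ 1) :+ con (+ 1)) :* O)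
              := c :* (w :* i) :* S :- ((con (+ 1) :+ (con (+ 1) :+ con (+ 0))) :* c) :* i :* O)
             refl c (w ⁻¹) w S O ⟩
      c * (w * w ⁻¹) * S - (fromℕ 2 * c) * w ⁻¹ * O
        ≈⟨ +-congʳ (*-congʳ (*-congˡ (*-inverseʳ (0<⇒≉0 w-pos)))) ⟩
      c * 1# * S - (fromℕ 2 * c) * w ⁻¹ * O
        ≈⟨ solve 4 (λ c S x O → c :* con (+ 1) :* S :- x :* O
              := (con (+ 1) :+ c :- x) :* O :- ((con (+ 1) :+ c) :* O :- c :* S))
             refl c S ((fromℕ 2 * c) * w ⁻¹) O ⟩
      α k c * O - ((1# + c) * O - c * S) ∎

  -- Residual sizes after the trigger

  module _ (distinct : AllPairs (λ i j → ¬ (i ≡ j)) unfinished) (pₑ≰uₑ : ¬ (p e ≤ u e)) where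

    0≤p : ∀ j → 0# ≤ p j
    0≤p j = ≤-trans (proj₁ 0<s₀) (s₀≤p j)

    0≤r : ∀ j → 0# ≤ r j
    0≤r j with j Finₚ.≟ e
    ... | yes ≡.refl = x≤y⇒0≤y-x (≰⇒≥ pₑ≰uₑ)
    ... | no  _      = 0≤p j

    r≤s₁ : ∀ j → r j ≤ s₁
    r≤s₁ j with j Finₚ.≟ e
    -- The residual of `e` is at most `p e` because `0# < ℓ e` and `ℓ e ≤ u e` make `u e`
    -- nonnegative.
    ... | yes ≡.refl = ≤-trans (0≤y-x⇒x≤y (≤-respʳ-≈ (solve 2 (λ p u → u := p :- (p :- u)) refl (p e) (u e))
                         (≤-trans (proj₁ (0<ℓ e)) (ℓ≤u e)))) (p≤s₁ e)
    ... | no  _      = p≤s₁ j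

    s₀≤r-later : All (λ j → s₀ ≤ r j) later
    s₀≤r-later = All.map s₀≤r (AllPairs.head distinct)
      where
      s₀≤r : ∀ {j} → ¬ (e ≡ j) → s₀ ≤ r j
      s₀≤r {j} e≢j with j Finₚ.≟ e
      ... | yes j≡e = contradiction (≡.sym j≡e) e≢j
      ... | no  _   = s₀≤p j

    0≤residuals : All (0# ≤_) residuals
    0≤residuals = Allₚ.map⁺ (All.universal 0≤r unfinished)

    S M : Carrier
    S = sum residuals
    M = pairSum _⊓_ residuals

    -- Converts the interruption bound, stated in the total size, into one in OPT.
    S≤OPT : S ≤ OPT residuals
    S≤OPT = begin
      S              ≈⟨ +-identityʳ S ⟨
      S + 0#         ≤⟨ +-monoʳ-≤ S (pairSum-⊓-nonNeg 0≤residuals) ⟩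
      S + M          ≈⟨ OPT-pairSum residuals ⟨
      OPT residuals  ∎

    s₁≤last-threshold : ∀ k → 0# < D → s₁ ≤ threshold (ℕ.suc k) k
    s₁≤last-threshold k 0<D = ≤-reflexive (begin-equality
      s₁                                     ≈⟨ s₀*D≈s₁ ⟨
      s₀ * D                                 ≈⟨ *-congˡ (root-^ (ℕ.suc k) 0<D) ⟨
      s₀ * root (ℕ.suc k) D ^ ℕ.suc k        ≡⟨ ≡.cong (λ n → s₀ * root (ℕ.suc k) D ^ n) (ℕₚ.+-comm k 1) ⟨
      threshold (ℕ.suc k) k                  ∎)

    all-covered : ∀ k → 0# < D → All (Covered (thresholds (ℕ.suc k))) (map (λ j → j , 0#) unfinished)
    all-covered k 0<D = Allₚ.map⁺ (All.universal
      (λ j → Anyₚ.applyUpTo⁺ (threshold (ℕ.suc k)) (≤-trans (r≤s₁ j) (s₁≤last-threshold k 0<D)) ℕₚ.≤-refl) unfinished)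

    -- Bounds for D > 1

    module _ (1<D : 1# < D) where

      0<D : 0# < D
      0<D = <-≤-trans (0≤1 , 0≉1) (proj₁ 1<D)

      Fres-bound : ∀ K .{{_ : NonZero K}} → Fres K ≤ α m (root K D) * OPT residuals
      Fres-bound K@(ℕ.suc k) = begin
        Fres K
          ≤⟨ 0≤y-x⇒x≤y (≤-respʳ-≈ (solve 4 (λ S M F t → t :+ (S :+ M) :- (F :+ t) := S :+ M :- F)
                refl S ((1# + c) * M) (Fres K) (Σ (λ _ → τ) unfinished)) (x≤y⇒0≤y-x delayed)) ⟩
        S + (1# + c) * M
          ≈⟨ solve 3 (λ S M c → S :+ (con (+ 1) :+ c) :* M := (con (+ 1) :+ c) :* (S :+ M) :- c :* S) refl S M c ⟩
        (1# + c) * (S + M) - c * S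
          ≤⟨ OPT-fraction m (0≤c c 1≤c 0≤r) (≡.subst (λ n → (1# + 1#) * (S + M) ≤ (1# + fromℕ n) * S)
               (Listₚ.length-map r unfinished) (pairSum-⊓-≤ residuals)) ⟩
        α m c * (S + M)
          ≈⟨ *-congˡ (OPT-pairSum residuals) ⟨
        α m c * OPT residuals ∎
        where
        c = root K D
        1≤c = root-≥1 K 1<D
        as = map (λ j → j , 0#) unfinished
        T₀≤cr : ∀ {j} → s₀ ≤ r j → threshold K 0 ≤ c * r j
        T₀≤cr s₀≤rj = ≤-respˡ-≈ (trans (*-comm c s₀) (*-congˡ (sym (*-identityʳ c))))
          (*-monoˡ-nonNeg (0≤c c 1≤c 0≤r) s₀≤rj)
        growth : ∀ h → threshold K (ℕ.suc h) ≤ c * threshold K h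
        growth h = ≤-reflexive (solve 3 (λ s c x → s :* (c :* x) := c :* (s :* x)) refl s₀ c (c ^ (h ℕ.+ 1)))
        within : work τ as (G K) ≤ budget c 1≤c 0≤r τ as
        within = rounds-withinBudget c 1≤c 0≤r {x = 0#} (applyUpTo (threshold K ∘ ℕ.suc) k) as τ
          (Linkedₚ.applyUpTo⁺₂ (threshold K) K growth)
          (Allₚ.map⁺ (All.universal (λ j → ≤-refl , 0≤r j) unfinished))
          (AllPairs.zip (AllPairsₚ.map⁺ distinct ,
            -- The first threshold is `c * s₀`, so the size condition follows from `s₀ ≤ r j` for
            -- the jobs after `e`.
            AllPairsₚ.map⁺ (AllPairs-from-All (λ _ → T₀≤cr) e s₀≤r-later)))
          (all-covered k 0<D)
        delayed : Fres K + Σ (λ _ → τ) unfinished ≤ Σ (λ _ → τ) unfinished + (S + (1# + c) * M)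
        delayed = begin
          Fres K + Σ (λ _ → τ) unfinished     ≈⟨ Σ-completion-offset τ (G K) unfinished ⟩
          Σ (completion τ (G K)) unfinished   ≡⟨ Σ-map _ _ unfinished ⟨
          work τ as (G K)                     ≤⟨ within ⟩
          budget c 1≤c 0≤r τ as               ≈⟨ budget-initial c 1≤c 0≤r τ unfinished ⟩
          Σ (λ _ → τ) unfinished + (S + (1# + c) * M) ∎

      -- For `q = i + 1`, a job that survives `threshold K i` has `q` unfinished phases; at the rate
      -- `βterm D K q / s₀` the threshold itself pays for exactly `q`.
      interruption-price : ∀ K .{{_ : NonZero K}} i → ℕ.suc i ℕ.< K →
        fromℕ (ℕ.suc i) ≤ (β K D / s₀) * threshold K i
      interruption-price K i q<K = begin
        fromℕ q
          ≈⟨ *-identityʳ (fromℕ q) ⟨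
        fromℕ q * 1#
          ≈⟨ *-congˡ (⁻¹^n*^n≈1 q (0<⇒≉0 0<c)) ⟨
        fromℕ q * ((c ⁻¹) ^ q * c ^ q)
          ≈⟨ *-assoc (fromℕ q) ((c ⁻¹) ^ q) (c ^ q) ⟨
        βterm D K q * c ^ q
          ≤⟨ *-monoʳ-nonNeg (^-nonNeg q (proj₁ 0<c)) (βterm≤β K D i q<K) ⟩
        β K D * c ^ q
          ≈⟨ *-inverse-cancelˡ (0<⇒≉0 0<s₀) _ ⟨
        s₀ * (β K D * c ^ q * s₀ ⁻¹)
          ≈⟨ solve 4 (λ s B x i → s :* (B :* x :* i) := B :* i :* (s :* x)) refl s₀ (β K D) (c ^ q) (s₀ ⁻¹) ⟩
        (β K D / s₀) * (s₀ * c ^ q)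
          ≡⟨ ≡.cong (λ n → (β K D / s₀) * (s₀ * c ^ n)) (ℕₚ.+-comm i 1) ⟨
        (β K D / s₀) * threshold K i ∎
        where
        q = ℕ.suc i
        c = root K D
        0<c = root-pos K 0<D

      Pres-bound : ∀ K .{{_ : NonZero K}} → fromℕ (Pres K) ≤ (β K D / s₀) * S
      Pres-bound K@(ℕ.suc k) = begin
        fromℕ (Pres K)
          ≤⟨ fromℕ-mono (Pres≤incomplete K) ⟩
        fromℕ (incomplete (G K))
          ≈⟨ +-identityˡ _ ⟨
        0# + fromℕ (incomplete (G K))
          ≈⟨ +-congʳ (trans (Σ-const 0# as) (zeroʳ _)) ⟨
        Σ (λ _ → 0#) as + fromℕ (incomplete (G K))
          ≤⟨ rounds-charge b 0≤b K (threshold K) 0 as (interruption-price K)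
               (Allₚ.map⁺ (All.universal (λ j → *-nonNeg 0≤b (0≤r j)) unfinished)) (all-covered k 0<D) ⟩
        Σ (λ a → b * size a) as
          ≡⟨ Σ-map _ _ unfinished ⟩
        Σ (λ j → b * r j) unfinished
          ≈⟨ Σ-* b r unfinished ⟩
        b * S ∎
        where
        as = map (λ j → j , 0#) unfinished
        b = β K D / s₀
        0≤b : 0# ≤ b
        0≤b = *-nonNeg (β-nonNeg K D 0<D) (⁻¹-nonNeg 0<s₀)

      cost-bound : ∀ K .{{_ : NonZero K}} →
        Fres K + κ * fromℕ (Pres K) ≤ Ψ m D Λ K * OPT residuals
      cost-bound K = begin
        Fres K + κ * fromℕ (Pres K)
          ≤⟨ +-mono-≤ (Fres-bound K) (*-monoˡ-nonNeg 0≤κ (Pres-bound K)) ⟩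
        A * O + κ * ((B * s₀ ⁻¹) * S)
          ≤⟨ +-monoʳ-≤ (A * O) (*-monoˡ-nonNeg 0≤κ
               (*-monoˡ-nonNeg (*-nonNeg (β-nonNeg K D 0<D) (⁻¹-nonNeg 0<s₀)) S≤OPT)) ⟩
        A * O + κ * ((B * s₀ ⁻¹) * O)
          ≈⟨ solve 5 (λ A O κ B i → A :* O :+ κ :* (B :* i :* O) := (A :+ κ :* i :* B) :* O)
               refl A O κ B (s₀ ⁻¹) ⟩
        Ψ m D Λ K * O ∎
        where
        A = α m (root K D)
        B = β K D
        O = OPT residuals

    -- Exact cost for D = 1

    module _ (D≈1 : D ≈ 1#) where

      r≤threshold : All (λ j → r j ≤ threshold 1 0) unfinished
      r≤threshold = All.universal (λ j → ≤-trans (r≤s₁ j) (s₁≤last-threshold 0 D-pos)) unfinished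
        where
        D-pos : 0# < D
        D-pos = <-≤-trans (0≤1 , 0≉1) (≤-reflexive (sym D≈1))

      G1≡ : G 1 ≡ map (λ j → phase j (r j - 0#) true) unfinished
      G1≡ = single-round (threshold 1 0) unfinished r≤threshold

      -- Now `s₁` equals `s₀`: every residual is at most this value and those after `e` are at least
      -- this value, so the inherited order with `e` in front is already SPT.
      residuals-sorted : AllPairs _≤_ residuals
      residuals-sorted = AllPairsₚ.map⁺ (AllPairs-from-All (λ i s₀≤rj → ≤-trans (r≤s₁ i) (≤-trans s₁≤s₀ s₀≤rj)) e s₀≤r-later)
        where
        s₁≤s₀ : s₁ ≤ s₀
        s₁≤s₀ = ≤-reflexive (trans (sym s₀*D≈s₁) (trans (*-congˡ D≈1) (*-identityʳ s₀)))

      G1-SPT : SPT (G 1)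
      G1-SPT = ≡.subst SPT (≡.sym G1≡)
        ( Allₚ.map⁺ (All.universal (λ _ → ≡.refl) unfinished)
        , ≡.subst (_↭ unfinished) (≡.sym (≡.trans (≡.sym (Listₚ.map-∘ unfinished)) (Listₚ.map-id unfinished))) ↭-refl
        , ≡.subst (Sorted totalOrder) (Listₚ.map-∘ unfinished) (Sortedₚ.AllPairs⇒Sorted totalOrder residuals-sorted))

      Pres1≡0 : Pres 1 ≡ 0
      Pres1≡0 = ℕₚ.n≤0⇒n≡0 (≡.subst (Pres 1 ℕ.≤_)
        (≡.trans (≡.cong incomplete G1≡) (incomplete-nonpreemptive (λ j → r j - 0#) unfinished))
        (Pres≤incomplete 1))

      cost≈OPT : Fres 1 + κ * fromℕ (Pres 1) ≈ OPT residuals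
      cost≈OPT = begin-equality
        Fres 1 + κ * fromℕ (Pres 1)
          ≡⟨ ≡.cong (λ n → Fres 1 + κ * fromℕ n) Pres1≡0 ⟩
        Fres 1 + κ * 0#
          -- Adding and subtracting `t` passes from times since `τ` to absolute completion times.
          ≈⟨ solve 3 (λ F κ t → F :+ κ :* con (+ 0) := F :+ t :- t) refl (Fres 1) κ t ⟩
        Fres 1 + t - t
          ≈⟨ +-congʳ (Σ-completion-offset τ (G 1) unfinished) ⟩
        Σ (completion τ (G 1)) unfinished - t
          ≡⟨ ≡.cong (λ phs → Σ (completion τ phs) unfinished - t) G1≡ ⟩
        Σ (completion τ (map (λ j → phase j (r j - 0#) true) unfinished)) unfinished - t
          ≈⟨ +-congʳ (Σ-completion-nonpreemptive τ unfinished distinct) ⟩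
        t + suffixWeighted residuals - t
          ≈⟨ solve 2 (λ t W → t :+ W :- t := W) refl t (suffixWeighted residuals) ⟩
        suffixWeighted residuals
          ≈⟨ suffixWeighted-sorted residuals-sorted ⟩
        S + M
          ≈⟨ OPT-pairSum residuals ⟨
        OPT residuals ∎
        where t = Σ (λ _ → τ) unfinished

-- The state at the trigger

module _ {a ℓ₁ ℓ₂} (𝔽 : RootedOrderedField a ℓ₁ ℓ₂) where
  open RootedOrderedField 𝔽
  open Scheduling 𝔽

  module _ (I : Instance) where
    open Instance I
    open Trigger

    -- Supplies what the fallback bounds require of the trigger: `e` has a positive residual, and
    -- the unfinished jobs form a suffix of `π`, so they inherit distinctness.
    runUpper-trigger : ∀ t π {tr} → runUpper I t π ≡ just tr →
      ¬ (p (e tr) ≤ u (e tr)) × Σ[ done ∈ List (Job I) ] π ≡ done ++ e tr ∷ later tr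
    runUpper-trigger t (j ∷ js) eq with p j ≤? u j
    runUpper-trigger t (j ∷ js) eq     | yes _ with runUpper-trigger (t + p j) js eq
    ... | p≰u , done , js≡ = p≰u , j ∷ done , ≡.cong (j ∷_) js≡
    runUpper-trigger t (j ∷ js) ≡.refl | no pj≰uj = pj≰uj , [] , ≡.refl

    upperOrder-distinct : ∀ {π} → UpperEndpointOrder I π → Unique π
    upperOrder-distinct order = AllPairs.map precedes⇒≢ (UpperEndpointOrder.sorted order)
      where
      precedes⇒≢ : ∀ {i j} → u i < u j ⊎ (u i ≈ u j × label i ℕ.< label j) → ¬ (i ≡ j)
      precedes⇒≢ (inj₁ ui<uj)         ≡.refl = proj₂ ui<uj (OrderedFieldProperties.refl 𝔽)
      precedes⇒≢ (inj₂ (_ , labels<)) ≡.refl = ℕₚ.<-irrefl ≡.refl labels<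

theorem5p1 :
    ∀ {a ℓ₁ ℓ₂} (𝔽 : RootedOrderedField a ℓ₁ ℓ₂) →
    let open RootedOrderedField 𝔽
        open Scheduling 𝔽 in
    (I : Instance) (π : List (Job I)) → UpperEndpointOrder I π →
    (tr : Trigger I) → runUpper I 0# π ≡ just tr →
    let open Instance I
        open Fallback I tr in
    (1# < D → (K : ℕ) .{{_ : NonZero K}} →
        (Fres K ≤ α m (root K D) * OPT residuals)
      × (fromℕ (Pres K) ≤ (β K D / s₀) * sum residuals)
      × (Fres K + κ * fromℕ (Pres K) ≤ Ψ m D Λ K * OPT residuals))
    × (D ≈ 1# →
        SPT (G 1)
      × Pres 1 ≡ 0
      × Fres 1 + κ * fromℕ (Pres 1) ≈ OPT residuals)
theorem5p1 𝔽 I π order tr triggered with runUpper-trigger 𝔽 I _ π triggered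
... | pₑ≰uₑ , done , ≡.refl =
    (λ 1<D K → Fres-bound distinct pₑ≰uₑ 1<D K , Pres-bound distinct pₑ≰uₑ 1<D K , cost-bound distinct pₑ≰uₑ 1<D K)
  , (λ D≈1 → G1-SPT distinct pₑ≰uₑ D≈1 , Pres1≡0 distinct pₑ≰uₑ D≈1 , cost≈OPT distinct pₑ≰uₑ D≈1)
  where
  open FallbackBounds 𝔽 I tr
  distinct = AllPairs-++ʳ done (upperOrder-distinct 𝔽 I order)
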